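{- Let $f: D\to\{0,1\}$, $D\subseteq\{0,1\}^n$, be a non-constant $n$-bit partial Boolean function. Then $f$ can be computed exactly by a quantum 1-query algorithm if and only if there exists a vector $\vec\beta=(\beta_0,\beta_1,\dots,\beta_n)^T$ with all $\beta_i\ge 0$, $\beta_0+\beta_1+\cdots+\beta_n=1$, and $$\beta_0+\sum_{i=1}^n \beta_i(-1)^{x_i\oplus y_i}=0$$ for all $x\in\{x\in D: f(x)=0\}$ and all $y\in\{y\in D: f(y)=1\}$ (i.e. $(|F(x\oplus y)\rangle_1)^T\vec\beta=0$).
   Context: An $n$-bit partial Boolean function is a map $f:D\to\{0,1\}$ with $D\subseteq\{0,1\}^n$. For $z\in\{0,1\}^n$, $|F(z)\rangle_1=(1,(-1)^{z_1},\dots,(-1)^{z_n})^T\in\mathbb{R}^{n+1}$. A quantum 1-query algorithm works in a finite-dimensional Hilbert space with orthonormal basis $\{|i,j'\rangle\}$, where $i\in\{0,1,\dots,n\}$ and $j'$ ranges over a finite set; for input $x\in\{0,1\}^n$ the oracle is the unitary $O_x|i,j'\rangle=(-1)^{x_i}|i,j'\rangle$ for $i\in\{1,\dots,n\}$ and $O_x|0,j'\rangle=|0,j'\rangle$. The algorithm consists of an initial state $|\psi_0\rangle$, input-independent unitaries $U_0,U_1$, and a projective measurement with outcomes in $\{0,1\}$ applied to $U_1O_xU_0|\psi_0\rangle$. It computes $f$ exactly if for every $x\in D$ the outcome equals $f(x)$ with probability $1$. -}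

module Defs where

open import Algebra.Bundles using (CommutativeRing)
open import Algebra.Bundles.Raw using (RawRing)
open import Algebra.Structures using (IsCommutativeRing)
import Algebra.Definitions.RawMonoid as RawMonoidDefs
open import Data.Bool.Base using (Bool; true; false; if_then_else_)
open import Data.Fin.Base using (Fin; zero; suc)
import Data.Fin.Properties as Fin
open import Data.Maybe.Base using (Maybe; just)
open import Data.Nat.Base using (ℕ; suc)
open import Data.Product.Base using (_×_; _,_; ∃; ∃-syntax; proj₁)
open import Data.Product.Properties using (≡-dec)
open import Data.Vec.Base using (Vec; lookup)
open import Relation.Binary.Core using (Rel)
open import Relation.Binary.Definitions using (DecidableEquality)
open import Relation.Binary.PropositionalEquality.Core using (_≡_; _≢_)
open import Relation.Binary.Structures using (IsDecTotalOrder)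
open import Relation.Nullary.Decidable.Core using (does)
open import Relation.Nullary.Negation.Core using (¬_)
open import Relation.Unary using (Pred)
open import Level using (0ℓ) renaming (suc to lsuc)

-- The real numbers, axiomatised as a Dedekind-complete ordered field.  The
-- axioms are the classical ones: the order is total and decidable, and every
-- inhabited predicate that is bounded above has a supremum.  Classically they
-- determine the field up to unique isomorphism.

record CompleteOrderedField : Set (lsuc 0ℓ) where
  infix  8 -_
  infixl 7 _*_
  infixl 6 _+_
  infix  4 _≈_ _≤_
  field
    Carrier           : Set
    _≈_               : Rel Carrier 0ℓ
    _≤_               : Rel Carrier 0ℓ
    _+_ _*_           : Carrier → Carrier → Carrier
    -_                : Carrier → Carrier
    0# 1#             : Carrier
    isCommutativeRing : IsCommutativeRing _≈_ _+_ _*_ -_ 0# 1#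
    1≉0               : ¬ (1# ≈ 0#)
    inverse           : ∀ x → ¬ (x ≈ 0#) → ∃[ y ] x * y ≈ 1#
    isDecTotalOrder   : IsDecTotalOrder _≈_ _≤_
    +-monoˡ-≤         : ∀ z {x y} → x ≤ y → x + z ≤ y + z
    *-nonNeg          : ∀ {x y} → 0# ≤ x → 0# ≤ y → 0# ≤ x * y

  UpperBound : Pred Carrier 0ℓ → Carrier → Set
  UpperBound P u = ∀ x → P x → x ≤ u

  field
    supremum : (P : Pred Carrier 0ℓ) → ∃ P → ∃ (UpperBound P) →
               ∃[ s ] UpperBound P s × (∀ u → UpperBound P u → s ≤ u)

  commutativeRing : CommutativeRing 0ℓ 0ℓ
  commutativeRing = record { isCommutativeRing = isCommutativeRing }

  open CommutativeRing commutativeRing public using (_-_; +-rawMonoid)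
  open RawMonoidDefs +-rawMonoid public using (sum)

  -- (-1)ᵇ
  sign : Bool → Carrier
  sign b = if b then - 1# else 1#

-- The domain D of a partial function f is { x ∣ f x ≡ just b for some b }.

PartialBooleanFunction : ℕ → Set
PartialBooleanFunction n = Vec Bool n → Maybe Bool

NonConstant : ∀ {n} → PartialBooleanFunction n → Set
NonConstant f =
  ∃[ x ] ∃[ y ] ∃[ b ] ∃[ c ] f x ≡ just b × f y ≡ just c × b ≢ c

module Complex (ℝ : CompleteOrderedField) where
  open CompleteOrderedField ℝ

  record ℂ : Set where
    constructor _+i_
    field
      re im : Carrier
  open ℂ public

  ℂ-rawRing : RawRing 0ℓ 0ℓ
  ℂ-rawRing = record
    { Carrier = ℂ
    ; _≈_     = λ z w → re z ≈ re w × im z ≈ im w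
    ; _+_     = λ z w → (re z + re w) +i (im z + im w)
    ; _*_     = λ z w → (re z * re w - im z * im w) +i (re z * im w + im z * re w)
    ; -_      = λ z → (- re z) +i (- im z)
    ; 0#      = 0# +i 0#
    ; 1#      = 1# +i 0#
    }

  conj : ℂ → ℂ
  conj z = re z +i (- im z)

  ∣_∣² : ℂ → Carrier
  ∣ z ∣² = re z * re z + im z * im z

module Quantum (ℝ : CompleteOrderedField) where
  open CompleteOrderedField ℝ using () renaming
    (Carrier to R; _≈_ to _≈ᵣ_; 1# to 1ᵣ; sum to sumᵣ)
  open Complex ℝ
  open RawRing ℂ-rawRing using (_≈_; _+_; _*_; -_; 0#; 1#; +-rawMonoid)
  open RawMonoidDefs +-rawMonoid using (sum)

  -- (i , j) labels ∣i,j⟩: the query index i ranges over {0,…,n}, and suc k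
  -- stands for the k-th input bit (bits being counted from zero : Fin n).
  Basis : ℕ → ℕ → Set
  Basis n m = Fin (suc n) × Fin m

  _≟_ : ∀ {n m} → DecidableEquality (Basis n m)
  _≟_ = ≡-dec Fin._≟_ Fin._≟_

  module _ {n m : ℕ} where

    State : Set
    State = Basis n m → ℂ

    -- Matrices in the basis ∣i,j⟩: A b c is ⟨b∣A∣c⟩.
    Operator : Set
    Operator = Basis n m → Basis n m → ℂ

    ∑ : State → ℂ
    ∑ ψ = sum λ i → sum λ j → ψ (i , j)

    ket : Basis n m → State
    ket c b = if does (b ≟ c) then 1# else 0#

    ∥_∥² : State → R
    ∥ ψ ∥² = sumᵣ λ i → sumᵣ λ j → ∣ ψ (i , j) ∣²

    infix  4 _≋_
    infixl 6 _⊞_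
    infixl 7 _⊡_
    infixr 8 _·_
    infix  9 _†

    _≋_ : Operator → Operator → Set
    A ≋ B = ∀ b c → A b c ≈ B b c

    𝟘 𝟙 : Operator
    𝟘 b c = 0#
    𝟙 b c = ket c b

    _⊞_ _⊡_ : Operator → Operator → Operator
    (A ⊞ B) b c = A b c + B b c
    (A ⊡ B) b c = ∑ λ d → A b d * B d c

    _† : Operator → Operator
    (A †) b c = conj (A c b)

    _·_ : Operator → State → State
    (A · ψ) b = ∑ λ c → A b c * ψ c

    record Unitary (U : Operator) : Set where
      field
        U†U≋𝟙 : U † ⊡ U ≋ 𝟙
        UU†≋𝟙 : U ⊡ U † ≋ 𝟙

    record ProjectiveMeasurement (P : Bool → Operator) : Set where
      field
        selfAdjoint : ∀ b → P b † ≋ P b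
        idempotent  : ∀ b → P b ⊡ P b ≋ P b
        orthogonal  : ∀ b c → b ≢ c → P b ⊡ P c ≋ 𝟘
        complete    : P false ⊞ P true ≋ 𝟙

    phase : Vec Bool n → Fin (suc n) → ℂ
    phase x zero    = 1#
    phase x (suc k) = if lookup x k then - 1# else 1#

    -- Column c is O_x∣c⟩.
    oracle : Vec Bool n → Operator
    oracle x b c = phase x (proj₁ c) * ket c b

  record OneQueryAlgorithm (n : ℕ) : Set where
    field
      m           : ℕ
      ψ₀          : State {n} {m}
      U₀ U₁       : Operator {n} {m}
      P           : Bool → Operator {n} {m}
      normalised  : ∥ ψ₀ ∥² ≈ᵣ 1ᵣ
      U₀-unitary  : Unitary U₀
      U₁-unitary  : Unitary U₁
      measurement : ProjectiveMeasurement P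

    finalState : Vec Bool n → State
    finalState x = U₁ · oracle x · U₀ · ψ₀

    probability : Vec Bool n → Bool → R
    probability x b = ∥ P b · finalState x ∥²

  ComputesExactly : ∀ {n} → OneQueryAlgorithm n → PartialBooleanFunction n → Set
  ComputesExactly A f = ∀ x b → f x ≡ just b → probability x b ≈ᵣ 1ᵣ
    where open OneQueryAlgorithm A

  OneQueryComputable : ∀ {n} → PartialBooleanFunction n → Set
  OneQueryComputable {n} f = ∃[ A ] ComputesExactly {n} A f

{-# OPTIONS --safe #-}
module Submission where

-- For φ = U₀ ψ₀ and βᵢ = Σⱼ ∣φ(i,j)∣², the final states on x and y have inner
-- product β₀ + Σᵢ βᵢ (-1)^(xᵢ ⊕ yᵢ), because the oracle is diagonal and U₁ is
-- unitary.  An exact measurement forces final states with different answers to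
-- be orthogonal.  Conversely, start in the state Σᵢ √βᵢ ∣i⟩ with U₀ = U₁ = 1 and
-- let the outcome false be the projection onto the span of the final states of
-- the inputs with value 0, built by Gram–Schmidt.

open import Defs
open import Algebra.Bundles using (CommutativeRing)
open import Algebra.Bundles.Raw using (RawRing)
import Algebra.Properties.AbelianGroup as AbelianGroupProperties
import Algebra.Properties.Ring as RingProperties
import Algebra.Properties.Semiring.Mult as SemiringMult
import Algebra.Properties.Semiring.Mult.TCOptimised as OptimisedMult
import Algebra.Properties.Semiring.Sum as SemiringSum
import Algebra.Solver.Ring as RingSolver
open import Algebra.Solver.Ring.AlmostCommutativeRing
  using (fromCommutativeRing; _-Raw-AlmostCommutative⟶_)
open import Algebra.Structures using (IsCommutativeRing)
open import Data.Bool.Base using (Bool; true; false; if_then_else_; _xor_)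
import Data.Bool.Properties as Bool
open import Data.Fin.Base using (Fin; zero; suc; punchIn)
import Data.Fin.Properties as Fin
open import Data.List.Base using (List; []; _∷_; [_]; map; _++_; filter)
open import Data.List.Membership.Propositional using (_∈_)
open import Data.List.Membership.Propositional.Properties
  using (∈-++⁺ˡ; ∈-++⁺ʳ; ∈-map⁺; ∈-filter⁺; ∈-filter⁻)
open import Data.List.Relation.Unary.Any using (here; there)
open import Data.Maybe.Base using (Maybe; just; nothing)
import Data.Maybe.Properties as Maybe
open import Data.Nat.Base as ℕ using (ℕ; zero; suc)
import Data.Nat.Properties as ℕ
open import Data.Product.Base using (_×_; ∃; ∃-syntax; _,_; proj₁; proj₂)
open import Data.Product.Properties using (≡-dec)
open import Data.Sum.Base using (_⊎_; inj₁; inj₂)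
open import Data.Vec.Base using (Vec; lookup; []; _∷_)
open import Data.Vec.Functional using (Vector)
open import Function.Bundles using (_⇔_; mk⇔)
open import Level using (_⊔_)
open import Relation.Binary.PropositionalEquality.Core as ≡ using (_≡_; _≢_)
import Relation.Binary.Reasoning.Setoid as SetoidReasoning
open import Relation.Binary.Structures using (IsDecTotalOrder)
open import Relation.Nullary.Decidable using (dec-true; dec-false; does; yes; no)
open import Relation.Nullary.Negation.Core using (¬_; contradiction)

-- Orthogonality is required only between the two classes of final states; within one class the
-- states may be linearly dependent. Gram-Schmidt must therefore decide whether a new state already
-- lies in the current span, which the decidable equality of the reals makes possible. The process
-- extends a projector instead of an orthonormal basis: a rank-one term is scaled by an inverse
-- squared norm, so the only square roots ever taken are the amplitudes √βᵢ. These are not among the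
-- axioms of the reals and have to be obtained from suprema. The phases are real, hence so are the
-- inner products, and a single real equation expresses each orthogonality.

-- Polynomial identities with integer coefficients in a commutative ring

module IntegerCoefficientSolver {c ℓ} (R : CommutativeRing c ℓ) where
  open CommutativeRing R hiding (zero)
  open RingProperties ring using (x[y-z]≈xy-xz; [y-z]x≈yx-zx)
  open AbelianGroupProperties +-abelianGroup using (ε⁻¹≈ε; ⁻¹-anti-homo‿-; ⁻¹-∙-comm)
  open SemiringMult semiring using (×-homo-+; ×1-homo-*) renaming (_×_ to _⊗_)
  open OptimisedMult semiring using (×ᵤ≈×) renaming (_×_ to _⊗′_)
  open SetoidReasoning setoid

  private
    medial : ∀ a b c d → (a + b) + (c + d) ≈ (a + c) + (b + d)
    medial a b c d = begin
      (a + b) + (c + d) ≈⟨ +-assoc a b (c + d) ⟩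
      a + (b + (c + d)) ≈⟨ +-congˡ (+-assoc b c d) ⟨
      a + ((b + c) + d) ≈⟨ +-congˡ (+-congʳ (+-comm b c)) ⟩
      a + ((c + b) + d) ≈⟨ +-congˡ (+-assoc c b d) ⟩
      a + (c + (b + d)) ≈⟨ +-assoc a c (b + d) ⟨
      (a + c) + (b + d) ∎

    difference : ℕ × ℕ → Carrier
    difference (a , b) = a ⊗ 1# - b ⊗ 1#

    -- Agrees with difference, but makes (1 , 0) denote 1# definitionally.
    ⟦_⟧ : ℕ × ℕ → Carrier
    ⟦ a , zero  ⟧ = a ⊗′ 1#
    ⟦ a , suc b ⟧ = a ⊗ 1# - suc b ⊗ 1#

    ⟦⟧≈ : ∀ p → ⟦ p ⟧ ≈ difference p
    ⟦⟧≈ (a , zero) = begin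
      a ⊗′ 1#          ≈⟨ ×ᵤ≈× a 1# ⟨
      a ⊗ 1#           ≈⟨ +-identityʳ _ ⟨
      a ⊗ 1# + 0#      ≈⟨ +-congˡ ε⁻¹≈ε ⟨
      a ⊗ 1# - 0#      ∎
    ⟦⟧≈ (a , suc b) = refl

    -- Equal polynomials must have identical normal forms, so coefficients are
    -- kept reduced.
    cancel : ℕ → ℕ → ℕ × ℕ
    cancel zero    b       = zero , b
    cancel (suc a) zero    = suc a , zero
    cancel (suc a) (suc b) = cancel a b

    difference-cancel : ∀ a b → difference (cancel a b) ≈ a ⊗ 1# - b ⊗ 1#
    difference-cancel zero    b       = refl
    difference-cancel (suc a) zero    = refl
    difference-cancel (suc a) (suc b) = begin
      difference (cancel a b)                   ≈⟨ difference-cancel a b ⟩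
      a ⊗ 1# - b ⊗ 1#                           ≈⟨ +-identityˡ _ ⟨
      0# + (a ⊗ 1# - b ⊗ 1#)                    ≈⟨ +-congʳ (-‿inverseʳ 1#) ⟨
      (1# - 1#) + (a ⊗ 1# - b ⊗ 1#)             ≈⟨ medial _ _ _ _ ⟩
      (1# + a ⊗ 1#) + (- 1# - b ⊗ 1#)           ≈⟨ +-congˡ (⁻¹-∙-comm _ _) ⟩
      (1# + a ⊗ 1#) - (1# + b ⊗ 1#)             ∎

    -- The integers, with `(a , b)` standing for a - b. They serve as coefficients because their
    -- equality can be decided, while that of an abstract commutative ring cannot.
    ℕ² : RawRing _ _
    ℕ² = record
      { Carrier = ℕ × ℕ
      ; _≈_ = _≡_
      ; _+_ = λ { (a , b) (c , d) → cancel (a ℕ.+ c) (b ℕ.+ d) }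
      ; _*_ = λ { (a , b) (c , d) → cancel (a ℕ.* c ℕ.+ b ℕ.* d) (a ℕ.* d ℕ.+ b ℕ.* c) }
      ; -_ = λ { (a , b) → (b , a) }
      ; 0# = (0 , 0)
      ; 1# = (1 , 0)
      }
    module ℕ² = RawRing ℕ²

    difference-+ : ∀ p q → difference (p ℕ².+ q) ≈ difference p + difference q
    difference-+ (a , b) (c , d) = begin
      difference (cancel (a ℕ.+ c) (b ℕ.+ d))     ≈⟨ difference-cancel (a ℕ.+ c) (b ℕ.+ d) ⟩
      (a ℕ.+ c) ⊗ 1# - (b ℕ.+ d) ⊗ 1#             ≈⟨ +-cong (×-homo-+ 1# a c) (-‿cong (×-homo-+ 1# b d)) ⟩
      (a ⊗ 1# + c ⊗ 1#) - (b ⊗ 1# + d ⊗ 1#)       ≈⟨ +-congˡ (⁻¹-∙-comm _ _) ⟨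
      (a ⊗ 1# + c ⊗ 1#) + (- (b ⊗ 1#) - d ⊗ 1#)   ≈⟨ medial _ _ _ _ ⟩
      (a ⊗ 1# - b ⊗ 1#) + (c ⊗ 1# - d ⊗ 1#)       ∎

    difference-* : ∀ p q → difference (p ℕ².* q) ≈ difference p * difference q
    difference-* (a , b) (c , d) = begin
      difference (cancel (a ℕ.* c ℕ.+ b ℕ.* d) (a ℕ.* d ℕ.+ b ℕ.* c))
        ≈⟨ difference-cancel (a ℕ.* c ℕ.+ b ℕ.* d) (a ℕ.* d ℕ.+ b ℕ.* c) ⟩
      (a ℕ.* c ℕ.+ b ℕ.* d) ⊗ 1# - (a ℕ.* d ℕ.+ b ℕ.* c) ⊗ 1#  ≈⟨ +-cong (hom a c b d) (-‿cong (hom a d b c)) ⟩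
      (A * C + B * D) - (A * D + B * C)         ≈⟨ +-congˡ (-‿cong (+-comm _ _)) ⟩
      (A * C + B * D) - (B * C + A * D)         ≈⟨ +-congˡ (⁻¹-∙-comm _ _) ⟨
      (A * C + B * D) + (- (B * C) - A * D)     ≈⟨ medial _ _ _ _ ⟩
      (A * C - B * C) + (B * D - A * D)         ≈⟨ +-congˡ (⁻¹-anti-homo‿- _ _) ⟨
      (A * C - B * C) - (A * D - B * D)         ≈⟨ +-cong ([y-z]x≈yx-zx C A B) (-‿cong ([y-z]x≈yx-zx D A B)) ⟨
      (A - B) * C - (A - B) * D                 ≈⟨ x[y-z]≈xy-xz (A - B) C D ⟨
      (A - B) * (C - D)                         ∎
      where
      A = a ⊗ 1#
      B = b ⊗ 1#
      C = c ⊗ 1#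
      D = d ⊗ 1#
      hom : ∀ k l m n → (k ℕ.* l ℕ.+ m ℕ.* n) ⊗ 1# ≈ k ⊗ 1# * l ⊗ 1# + m ⊗ 1# * n ⊗ 1#
      hom k l m n = trans (×-homo-+ 1# (k ℕ.* l) (m ℕ.* n)) (+-cong (×1-homo-* k l) (×1-homo-* m n))

    morphism : ℕ² -Raw-AlmostCommutative⟶ fromCommutativeRing R
    morphism = record
      { ⟦_⟧    = ⟦_⟧
      ; +-homo = λ p q → trans (⟦⟧≈ (p ℕ².+ q)) (trans (difference-+ p q) (sym (+-cong (⟦⟧≈ p) (⟦⟧≈ q))))
      ; *-homo = λ p q → trans (⟦⟧≈ (p ℕ².* q)) (trans (difference-* p q) (sym (*-cong (⟦⟧≈ p) (⟦⟧≈ q))))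
      ; -‿homo = λ p → trans (⟦⟧≈ (ℕ².- p)) (trans (sym (⁻¹-anti-homo‿- _ _)) (-‿cong (sym (⟦⟧≈ p))))
      ; 0-homo = refl
      ; 1-homo = refl
      }

    _≟′_ : ∀ p q → Maybe (⟦ p ⟧ ≈ ⟦ q ⟧)
    p ≟′ q with ≡-dec ℕ._≟_ ℕ._≟_ p q
    ... | no  _  = nothing
    ... | yes eq = just (reflexive (≡.cong ⟦_⟧ eq))

  open RingSolver ℕ² (fromCommutativeRing R) morphism _≟′_ public
    using (Polynomial; con; solve; _:=_; _:+_; _:*_; _:-_; :-_)

  :0 :1 : ∀ {n} → Polynomial n
  :0 = con ℕ².0#
  :1 = con ℕ².1#

-- Order, squares and square roots in a complete ordered field

module OrderedFieldProperties (ℝ : CompleteOrderedField) where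
  open CompleteOrderedField ℝ
  open CommutativeRing commutativeRing using
    ( setoid; refl; sym; trans; +-congˡ; +-congʳ; *-congˡ; *-congʳ; -‿cong; +-comm; +-identityˡ; -‿inverseʳ
    ; *-assoc; *-identityˡ; *-identityʳ; zeroˡ; zeroʳ )
  open IsDecTotalOrder isDecTotalOrder public using (_≟_; total; antisym)
    renaming (reflexive to ≤-reflexive; trans to ≤-trans)
  open IntegerCoefficientSolver commutativeRing
  open SetoidReasoning setoid

  0≤-resp : ∀ {x y} → x ≈ y → 0# ≤ x → 0# ≤ y
  0≤-resp x≈y 0≤x = ≤-trans 0≤x (≤-reflexive x≈y)

  ≤⇒0≤- : ∀ {x y} → x ≤ y → 0# ≤ y - x
  ≤⇒0≤- {x} x≤y = ≤-trans (≤-reflexive (sym (-‿inverseʳ x))) (+-monoˡ-≤ (- x) x≤y)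

  0≤-⇒≤ : ∀ {x y} → 0# ≤ y - x → x ≤ y
  0≤-⇒≤ {x} {y} 0≤y-x =
    ≤-trans (≤-reflexive (sym (+-identityˡ x)))
      (≤-trans (+-monoˡ-≤ x 0≤y-x) (≤-reflexive (solve 2 (λ x y → y :- x :+ x := y) refl x y)))

  +-nonNeg : ∀ {x y} → 0# ≤ x → 0# ≤ y → 0# ≤ x + y
  +-nonNeg {x} {y} 0≤x 0≤y = ≤-trans 0≤y (≤-trans (≤-reflexive (sym (+-identityˡ y))) (+-monoˡ-≤ y 0≤x))

  -- Here `y` equals - x, so `x` and its negative are both nonnegative. Several equalities below
  -- arise this way, from a polynomial identity that writes zero as a sum of nonnegative terms.
  +-nonNeg-zeroˡ : ∀ {x y} → 0# ≤ x → 0# ≤ y → x + y ≈ 0# → x ≈ 0#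
  +-nonNeg-zeroˡ {x} {y} 0≤x 0≤y x+y≈0 =
    antisym (0≤-⇒≤ (0≤-resp (begin
      y                ≈⟨ solve 2 (λ x y → y := (x :+ y) :- x) refl x y ⟩
      (x + y) - x      ≈⟨ +-congʳ x+y≈0 ⟩
      0# - x           ∎) 0≤y)) 0≤x

  sum-nonNeg : ∀ {n} (f : Fin n → Carrier) → (∀ i → 0# ≤ f i) → 0# ≤ sum f
  sum-nonNeg {zero}  f 0≤f = ≤-reflexive refl
  sum-nonNeg {suc n} f 0≤f = +-nonNeg (0≤f zero) (sum-nonNeg (λ i → f (suc i)) (λ i → 0≤f (suc i)))

  sum-nonNeg-zero : ∀ {n} (f : Fin n → Carrier) → (∀ i → 0# ≤ f i) → sum f ≈ 0# → ∀ i → f i ≈ 0#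
  sum-nonNeg-zero f 0≤f sum≈0 zero =
    +-nonNeg-zeroˡ (0≤f zero) (sum-nonNeg _ (λ i → 0≤f (suc i))) sum≈0
  sum-nonNeg-zero f 0≤f sum≈0 (suc i) =
    sum-nonNeg-zero (λ j → f (suc j)) (λ j → 0≤f (suc j))
      (+-nonNeg-zeroˡ (sum-nonNeg _ (λ j → 0≤f (suc j))) (0≤f zero) (trans (+-comm _ _) sum≈0)) i

  square-nonNeg : ∀ x → 0# ≤ x * x
  square-nonNeg x with total 0# x
  ... | inj₁ 0≤x = *-nonNeg 0≤x 0≤x
  ... | inj₂ x≤0 = 0≤-resp (solve 1 (λ x → (:0 :- x) :* (:0 :- x) := x :* x) refl x)
                     (*-nonNeg (≤⇒0≤- x≤0) (≤⇒0≤- x≤0))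

  square-zero : ∀ {x} → x * x ≈ 0# → x ≈ 0#
  square-zero {x} xx≈0 with x ≟ 0#
  ... | yes x≈0 = x≈0
  ... | no  x≉0 with inverse x x≉0
  ...   | (y , xy≈1) = begin
    x            ≈⟨ *-identityʳ x ⟨
    x * 1#       ≈⟨ *-congˡ xy≈1 ⟨
    x * (x * y)  ≈⟨ *-assoc x x y ⟨
    x * x * y    ≈⟨ *-congʳ xx≈0 ⟩
    0# * y       ≈⟨ zeroˡ y ⟩
    0#           ∎

  0≤1 : 0# ≤ 1#
  0≤1 = 0≤-resp (*-identityˡ 1#) (square-nonNeg 1#)

  -- `y` equals x y², a product of nonnegative factors.
  inverse-nonNeg : ∀ {x y} → x * y ≈ 1# → 0# ≤ x → 0# ≤ y
  inverse-nonNeg {x} {y} xy≈1 0≤x = 0≤-resp (begin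
    x * (y * y)  ≈⟨ *-assoc x y y ⟨
    x * y * y    ≈⟨ *-congʳ xy≈1 ⟩
    1# * y       ≈⟨ *-identityˡ y ⟩
    y            ∎) (*-nonNeg 0≤x (square-nonNeg y))

  -- If `y ≤ x`, then (x - y)² + 2y(x - y) + (y² - x²) = 0 is a vanishing sum of nonnegative terms,
  -- which forces x = y.
  square-cancel-≤ : ∀ {x y} → 0# ≤ y → x * x ≤ y * y → x ≤ y
  square-cancel-≤ {x} {y} 0≤y xx≤yy with total x y
  ... | inj₁ x≤y = x≤y
  ... | inj₂ y≤x = 0≤-⇒≤ (≤-reflexive (sym (begin
    y - x        ≈⟨ solve 2 (λ x y → y :- x := :- (x :- y)) refl x y ⟩
    - (x - y)    ≈⟨ -‿cong (square-zero x-y²≈0) ⟩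
    - 0#         ≈⟨ solve 0 (:- :0 := :0) refl ⟩
    0#           ∎)))
    where
    0≤x-y = ≤⇒0≤- y≤x
    x-y²≈0 : (x - y) * (x - y) ≈ 0#
    x-y²≈0 = +-nonNeg-zeroˡ (square-nonNeg (x - y))
      (+-nonNeg (*-nonNeg (+-nonNeg 0≤y 0≤y) 0≤x-y) (≤⇒0≤- xx≤yy))
      (solve 2 (λ x y → (x :- y) :* (x :- y) :+ ((y :+ y) :* (x :- y) :+ (y :* y :- x :* x)) := :0) refl x y)

  -- The root is the supremum `s` of all nonnegative x with x² ≤ a. If s² differed from a, a small
  -- step away from `s` would produce either a larger member of this set or a smaller upper bound.
  sqrt : ∀ {a} → 0# ≤ a → ∃[ s ] s * s ≈ a
  sqrt {a} 0≤a = s , s²≈a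
    where
    Below : Carrier → Set
    Below x = (0# ≤ x) × (x * x ≤ a)

    bounded : UpperBound Below (a + 1#)
    -- The bound a + 1 works for small and for large a alike, since (a + 1)² - x² = (a - x²) + a² +
    -- a + 1.
    bounded x (_ , x²≤a) = square-cancel-≤ (+-nonNeg 0≤a 0≤1) (0≤-⇒≤ (0≤-resp
      (solve 2 (λ a x → (a :- x :* x) :+ (a :* a :+ (a :+ :1)) := (a :+ :1) :* (a :+ :1) :- x :* x) refl a x)
      (+-nonNeg (≤⇒0≤- x²≤a) (+-nonNeg (square-nonNeg a) (+-nonNeg 0≤a 0≤1)))))

    0-below : Below 0#
    0-below = ≤-reflexive refl , ≤-trans (≤-reflexive (zeroˡ 0#)) 0≤a

    sup = supremum Below (0# , 0-below) (a + 1# , bounded)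
    s = proj₁ sup
    s-bounds = proj₁ (proj₂ sup)
    s-least = proj₂ (proj₂ sup)

    0≤s : 0# ≤ s
    0≤s = s-bounds 0# 0-below

    -- A gap d = ∣ a - s² ∣ lets s be moved by the step d q, where q = 1 / p.
    gap-closed : ∀ {d p q} → p * q ≈ 1# → 0# ≤ p → 0# ≤ d → 0# ≤ - (d * q) → d ≈ 0#
    gap-closed {d} {p} {q} pq≈1 0≤p 0≤d 0≤-ε =
      +-nonNeg-zeroˡ 0≤d (*-nonNeg 0≤-ε 0≤p) (begin
        d + - (d * q) * p   ≈⟨ solve 3 (λ d p q → d :+ (:- (d :* q)) :* p := d :* (:1 :- p :* q)) refl d p q ⟩
        d * (1# - p * q)    ≈⟨ *-congˡ (+-congˡ (-‿cong pq≈1)) ⟩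
        d * (1# - 1#)       ≈⟨ *-congˡ (-‿inverseʳ 1#) ⟩
        d * 0#              ≈⟨ zeroʳ d ⟩
        0#                  ∎)

    -- The ring solver does not know p q = 1; multiples of 1 - p q are dropped here.
    cancel-inverse : ∀ {u v x k} → u ≈ 1# → v ≈ x + k * (1# - u) → x ≈ v
    cancel-inverse {u} {v} {x} {k} u≈1 v≈ = sym (begin
      v                  ≈⟨ v≈ ⟩
      x + k * (1# - u)   ≈⟨ +-congˡ (*-congˡ (+-congˡ (-‿cong u≈1))) ⟩
      x + k * (1# - 1#)  ≈⟨ solve 2 (λ x k → x :+ k :* (:1 :- :1) := x) refl x k ⟩
      x                  ∎)

    difference-zero : ∀ {x y} → x - y ≈ 0# → x ≈ y
    difference-zero {x} {y} x-y≈0 = begin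
      x          ≈⟨ solve 2 (λ x y → x := (x :- y) :+ y) refl x y ⟩
      x - y + y  ≈⟨ +-congʳ x-y≈0 ⟩
      0# + y     ≈⟨ +-identityˡ y ⟩
      y          ∎

    s²≈a : s * s ≈ a
    s²≈a with total (s * s) a
    ... | inj₁ s²≤a = sym (difference-zero (gap-closed pq≈1 0≤p 0≤d
            (0≤-resp (solve 2 (λ s e → s :- (s :+ e) := :- e) refl s (d * q)) (≤⇒0≤- (s-bounds _ s+ε-below)))))
      where
      d = a - s * s
      0≤d = ≤⇒0≤- s²≤a
      -- With p = 1 + 2s + d the step ε = d / p satisfies ε ≤ 1, hence ε(2s + ε) ≤ ε(2s + 1) ≤ εp =
      -- d, which says (s + ε)² ≤ a. The summand 1 also keeps p away from zero when s and d vanish.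
      r = s + s + d
      0≤r = +-nonNeg (+-nonNeg 0≤s 0≤s) 0≤d
      p = 1# + r
      0≤p = +-nonNeg 0≤1 0≤r
      p≉0 : ¬ (p ≈ 0#)
      p≉0 p≈0 = 1≉0 (+-nonNeg-zeroˡ 0≤1 0≤r p≈0)
      q = proj₁ (inverse p p≉0)
      pq≈1 = proj₂ (inverse p p≉0)
      0≤q = inverse-nonNeg pq≈1 0≤p
      s+ε-below : Below (s + d * q)
      s+ε-below = +-nonNeg 0≤s (*-nonNeg 0≤d 0≤q) ,
        0≤-⇒≤ (0≤-resp
          (cancel-inverse pq≈1 (solve 3 (λ a s q →
            let d = a :- s :* s
                p = :1 :+ (s :+ s :+ d)
            in a :- (s :+ d :* q) :* (s :+ d :* q) :=
               d :* q :* ((:1 :+ (s :+ s)) :* q :+ d) :+ d :* (:1 :+ q) :* (:1 :- p :* q)) refl a s q))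
          (*-nonNeg (*-nonNeg 0≤d 0≤q)
            (+-nonNeg (*-nonNeg (+-nonNeg 0≤1 (+-nonNeg 0≤s 0≤s)) 0≤q) 0≤d)))
    ... | inj₂ a≤s² with s ≟ 0#
    -- The remaining case divides by 2s. For s = 0 the assumption a ≤ s² leaves only a = 0.
    ...   | yes s≈0 = difference-zero (+-nonNeg-zeroˡ (≤⇒0≤- a≤s²) 0≤a (begin
      s * s - a + a  ≈⟨ solve 2 (λ s a → s :* s :- a :+ a := s :* s) refl s a ⟩
      s * s          ≈⟨ *-congʳ s≈0 ⟩
      0# * s         ≈⟨ zeroˡ s ⟩
      0#             ∎))
    ...   | no  s≉0 = difference-zero (gap-closed pq≈1 0≤p 0≤d
            (0≤-resp (solve 2 (λ s e → s :- e :- s := :- e) refl s (d * q)) (≤⇒0≤- (s-least t t-bounds))))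
      where
      d = s * s - a
      0≤d = ≤⇒0≤- a≤s²
      p = s + s
      0≤p = +-nonNeg 0≤s 0≤s
      p≉0 : ¬ (p ≈ 0#)
      p≉0 p≈0 = s≉0 (+-nonNeg-zeroˡ 0≤s 0≤s p≈0)
      q = proj₁ (inverse p p≉0)
      pq≈1 = proj₂ (inverse p p≉0)
      0≤q = inverse-nonNeg pq≈1 0≤p
      -- Newton's step for the square root, t = (s² + a) / (2s): its square exceeds a by exactly (d
      -- q)², so t is again an upper bound.
      t = s - d * q
      0≤t : 0# ≤ t
      0≤t = 0≤-resp
        (cancel-inverse pq≈1 (solve 3 (λ a s q →
          s :- (s :* s :- a) :* q := q :* (s :* s :+ a) :+ s :* (:1 :- (s :+ s) :* q)) refl a s q))
        (*-nonNeg 0≤q (+-nonNeg (square-nonNeg s) 0≤a))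
      a≤t² : a ≤ t * t
      a≤t² = 0≤-⇒≤ (0≤-resp
        (cancel-inverse pq≈1 (solve 3 (λ a s q →
          let d = s :* s :- a
              t = s :- d :* q
          in t :* t :- a := (d :* q) :* (d :* q) :+ d :* (:1 :- (s :+ s) :* q)) refl a s q))
        (square-nonNeg (d * q)))
      t-bounds : UpperBound Below t
      t-bounds x (_ , x²≤a) = square-cancel-≤ 0≤t (≤-trans x²≤a a≤t²)

-- Linear algebra over a commutative ring with conjugation

-- An involutive ring automorphism. The linear algebra below uses nothing else about complex
-- conjugation, and positivity enters it only through `Definite`.
record Conjugation {c ℓ} (K : CommutativeRing c ℓ) : Set (c ⊔ ℓ) where
  open CommutativeRing K
  field
    conj            : Carrier → Carrier
    conj-cong       : ∀ {x y} → x ≈ y → conj x ≈ conj y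
    conj-+          : ∀ x y → conj (x + y) ≈ conj x + conj y
    conj-*          : ∀ x y → conj (x * y) ≈ conj x * conj y
    conj-neg        : ∀ x → conj (- x) ≈ - conj x
    conj-0          : conj 0# ≈ 0#
    conj-1          : conj 1# ≈ 1#
    conj-involutive : ∀ x → conj (conj x) ≈ x

-- The operations below unfold to those of Quantum when K is ℂ; over an abstract
-- ring they do not reduce to real and imaginary parts.
module LinearAlgebra {c ℓ} (K : CommutativeRing c ℓ) (conjugation : Conjugation K) (k m : ℕ) where
  open CommutativeRing K hiding (zero)
  open Conjugation conjugation
  open SemiringSum semiring using
    (sum; sum-cong-≋; ∑-distrib-+; ∑-comm; *-distribˡ-sum; sum-remove; sum-replicate-zero)
  open IntegerCoefficientSolver K
  open SetoidReasoning setoid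

  Index = Fin k × Fin m
  State = Index → Carrier
  Operator = Index → Index → Carrier

  infix  4 _≈ₛ_ _≋_
  infixl 7 _⊡_
  infixr 8 _·_
  infix  9 _†

  _≈ₛ_ : State → State → Set ℓ
  ψ ≈ₛ φ = ∀ b → ψ b ≈ φ b

  _≋_ : Operator → Operator → Set ℓ
  A ≋ B = ∀ b c → A b c ≈ B b c

  ∑ : State → Carrier
  ∑ ψ = sum λ i → sum λ j → ψ (i , j)

  ket : Index → State
  ket c b = if does (≡-dec Fin._≟_ Fin._≟_ b c) then 1# else 0#

  𝟙 : Operator
  𝟙 b c = ket c b

  _⊡_ : Operator → Operator → Operator
  (A ⊡ B) b c = ∑ λ d → A b d * B d c

  _† : Operator → Operator
  (A †) b c = conj (A c b)

  _·_ : Operator → State → State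
  (A · ψ) b = ∑ λ c → A b c * ψ c

  ⟨_∣_⟩ : State → State → Carrier
  ⟨ ψ ∣ φ ⟩ = ∑ λ b → conj (ψ b) * φ b

  sum-single : ∀ {l} (f : Fin l → Carrier) i → (∀ j → j ≢ i → f j ≈ 0#) → sum f ≈ f i
  sum-single {suc l} f i f≈0 = begin
    sum f                                   ≈⟨ sum-remove {i = i} f ⟩
    f i + sum (λ j → f (punchIn i j))       ≈⟨ +-congˡ (sum-cong-≋ (λ j → f≈0 (punchIn i j) (Fin.punchInᵢ≢i i j))) ⟩
    f i + sum {l} (λ _ → 0#)                ≈⟨ +-congˡ (sum-replicate-zero l) ⟩
    f i + 0#                                ≈⟨ +-identityʳ (f i) ⟩
    f i                                     ∎

  ∑-cong : {ψ φ : State} → ψ ≈ₛ φ → ∑ ψ ≈ ∑ φ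
  ∑-cong ψ≈φ = sum-cong-≋ (λ i → sum-cong-≋ (λ j → ψ≈φ (i , j)))

  ∑-+ : (ψ φ : State) → ∑ (λ b → ψ b + φ b) ≈ ∑ ψ + ∑ φ
  ∑-+ ψ φ = trans (sum-cong-≋ (λ i → ∑-distrib-+ (λ j → ψ (i , j)) (λ j → φ (i , j))))
                  (∑-distrib-+ (λ i → sum (λ j → ψ (i , j))) (λ i → sum (λ j → φ (i , j))))

  *-∑ : ∀ z (ψ : State) → z * ∑ ψ ≈ ∑ (λ b → z * ψ b)
  *-∑ z ψ = trans (*-distribˡ-sum z (λ i → sum (λ j → ψ (i , j)))) (sum-cong-≋ (λ i → *-distribˡ-sum z (λ j → ψ (i , j))))

  ∑-0 : ∑ (λ _ → 0#) ≈ 0#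
  ∑-0 = trans (sum-cong-≋ {k} (λ _ → sum-replicate-zero m)) (sum-replicate-zero k)

  ∑-swap : (F : Index → State) → ∑ (λ b → ∑ (λ c → F b c)) ≈ ∑ (λ c → ∑ (λ b → F b c))
  ∑-swap F = begin
    sum (λ i → sum (λ j → sum (λ k → sum (λ l → F (i , j) (k , l)))))
      ≈⟨ sum-cong-≋ (λ i → ∑-comm (λ j k → sum (λ l → F (i , j) (k , l)))) ⟩
    sum (λ i → sum (λ k → sum (λ j → sum (λ l → F (i , j) (k , l)))))
      ≈⟨ ∑-comm (λ i k → sum (λ j → sum (λ l → F (i , j) (k , l)))) ⟩
    sum (λ k → sum (λ i → sum (λ j → sum (λ l → F (i , j) (k , l)))))
      ≈⟨ sum-cong-≋ (λ k → sum-cong-≋ (λ i → ∑-comm (λ j l → F (i , j) (k , l)))) ⟩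
    sum (λ k → sum (λ i → sum (λ l → sum (λ j → F (i , j) (k , l)))))
      ≈⟨ sum-cong-≋ (λ k → ∑-comm (λ i l → sum (λ j → F (i , j) (k , l)))) ⟩
    sum (λ k → sum (λ l → sum (λ i → sum (λ j → F (i , j) (k , l))))) ∎

  conj-sum : ∀ {l} (f : Fin l → Carrier) → conj (sum f) ≈ sum (λ i → conj (f i))
  conj-sum {zero}  f = conj-0
  conj-sum {suc l} f = trans (conj-+ _ _) (+-congˡ (conj-sum (λ i → f (suc i))))

  conj-∑ : (ψ : State) → conj (∑ ψ) ≈ ∑ (λ b → conj (ψ b))
  conj-∑ ψ = trans (conj-sum (λ i → sum (λ j → ψ (i , j)))) (sum-cong-≋ (λ i → conj-sum (λ j → ψ (i , j))))

  ket-self : (b : Index) → ket b b ≡ 1#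
  ket-self b = ≡.cong (λ t → if t then 1# else 0#) (dec-true (≡-dec Fin._≟_ Fin._≟_ b b) ≡.refl)

  ket-other : {b c : Index} → b ≢ c → ket c b ≡ 0#
  ket-other {b} {c} b≢c = ≡.cong (λ t → if t then 1# else 0#) (dec-false (≡-dec Fin._≟_ Fin._≟_ b c) b≢c)

  ket-sym : (b c : Index) → ket b c ≡ ket c b
  ket-sym b c with ≡-dec Fin._≟_ Fin._≟_ c b
  ... | yes ≡.refl = ≡.sym (ket-self b)
  ... | no  c≢b    = ≡.sym (ket-other (λ b≡c → c≢b (≡.sym b≡c)))

  conj-ket : (c b : Index) → conj (ket c b) ≈ ket c b
  conj-ket c b with does (≡-dec Fin._≟_ Fin._≟_ b c)
  ... | true  = conj-1
  ... | false = conj-0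

  𝟙-· : (ψ : State) → 𝟙 · ψ ≈ₛ ψ
  𝟙-· ψ (i , j) = begin
    ∑ (λ c → ket c (i , j) * ψ c)
      ≈⟨ sum-single (λ k → sum (λ l → ket (k , l) (i , j) * ψ (k , l))) i
           (λ k k≢i → trans
             (sum-cong-≋ (λ l → off {k , l} (λ eq → k≢i (≡.sym (≡.cong proj₁ eq)))))
             (sum-replicate-zero m)) ⟩
    sum (λ l → ket (i , l) (i , j) * ψ (i , l))
      ≈⟨ sum-single (λ l → ket (i , l) (i , j) * ψ (i , l)) j
           (λ l l≢j → off {i , l} (λ eq → l≢j (≡.sym (≡.cong proj₂ eq)))) ⟩
    ket (i , j) (i , j) * ψ (i , j)  ≈⟨ *-congʳ (reflexive (ket-self (i , j))) ⟩
    1# * ψ (i , j)                   ≈⟨ *-identityˡ (ψ (i , j)) ⟩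
    ψ (i , j)                        ∎
    where
    off : ∀ {c} → (i , j) ≢ c → ket c (i , j) * ψ c ≈ 0#
    off {c} b≢c = trans (*-congʳ (reflexive (ket-other b≢c))) (zeroˡ (ψ c))

  ·-cong : {A B : Operator} {ψ φ : State} → A ≋ B → ψ ≈ₛ φ → A · ψ ≈ₛ B · φ
  ·-cong A≋B ψ≈φ b = ∑-cong (λ c → *-cong (A≋B b c) (ψ≈φ c))

  ·-congˡ : (A : Operator) {ψ φ : State} → ψ ≈ₛ φ → A · ψ ≈ₛ A · φ
  ·-congˡ A ψ≈φ b = ∑-cong (λ c → *-congˡ (ψ≈φ c))

  -- Since `ket` is symmetric in its two indices, the sum is `𝟙` acting on the row `A b`.
  ·-ket : (A : Operator) (c : Index) → A · ket c ≈ₛ λ b → A b c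
  ·-ket A c b = trans
    (∑-cong (λ d → trans (*-comm (A b d) (ket c d)) (*-congʳ (reflexive (ket-sym c d)))))
    (𝟙-· (A b) c)

  ·-assoc : (A B : Operator) (ψ : State) → (A ⊡ B) · ψ ≈ₛ A · (B · ψ)
  ·-assoc A B ψ b = begin
    ∑ (λ c → (A ⊡ B) b c * ψ c)                  ≈⟨ ∑-cong (λ c → *-comm ((A ⊡ B) b c) (ψ c)) ⟩
    ∑ (λ c → ψ c * ∑ (λ d → A b d * B d c))      ≈⟨ ∑-cong (λ c → *-∑ (ψ c) (λ d → A b d * B d c)) ⟩
    ∑ (λ c → ∑ (λ d → ψ c * (A b d * B d c)))    ≈⟨ ∑-swap (λ c d → ψ c * (A b d * B d c)) ⟩
    ∑ (λ d → ∑ (λ c → ψ c * (A b d * B d c)))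
      ≈⟨ ∑-cong (λ d → ∑-cong (λ c →
           solve 3 (λ x y z → x :* (y :* z) := y :* (z :* x)) refl (ψ c) (A b d) (B d c))) ⟩
    ∑ (λ d → ∑ (λ c → A b d * (B d c * ψ c)))    ≈⟨ ∑-cong (λ d → *-∑ (A b d) (λ c → B d c * ψ c)) ⟨
    ∑ (λ d → A b d * (B · ψ) d)                  ∎

  ·-+ : (A : Operator) (ψ φ : State) → A · (λ b → ψ b + φ b) ≈ₛ (λ b → (A · ψ) b + (A · φ) b)
  ·-+ A ψ φ b = trans (∑-cong (λ c → distribˡ (A b c) (ψ c) (φ c)))
                      (∑-+ (λ c → A b c * ψ c) (λ c → A b c * φ c))

  ·-* : (A : Operator) (z : Carrier) (ψ : State) → A · (λ b → z * ψ b) ≈ₛ (λ b → z * (A · ψ) b)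
  ·-* A z ψ b = trans
    (∑-cong (λ c → solve 3 (λ a z x → a :* (z :* x) := z :* (a :* x)) refl (A b c) z (ψ c)))
    (sym (*-∑ z (λ c → A b c * ψ c)))

  ·-- : (A : Operator) (ψ φ : State) → A · (λ b → ψ b - φ b) ≈ₛ (λ b → (A · ψ) b - (A · φ) b)
  ·-- A ψ φ b = begin
    (A · (λ b → ψ b - φ b)) b
      ≈⟨ ·-congˡ A (λ c → solve 2 (λ x y → x :- y := x :+ (:- :1) :* y) refl (ψ c) (φ c)) b ⟩
    (A · (λ b → ψ b + (- 1#) * φ b)) b       ≈⟨ ·-+ A ψ (λ b → (- 1#) * φ b) b ⟩
    (A · ψ) b + (A · (λ b → (- 1#) * φ b)) b ≈⟨ +-congˡ (·-* A (- 1#) φ b) ⟩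
    (A · ψ) b + (- 1#) * (A · φ) b           ≈⟨ solve 2 (λ x y → x :+ (:- :1) :* y := x :- y) refl ((A · ψ) b) ((A · φ) b) ⟩
    (A · ψ) b - (A · φ) b                    ∎

  ⟨⟩-cong : {ψ ψ′ φ φ′ : State} → ψ ≈ₛ ψ′ → φ ≈ₛ φ′ → ⟨ ψ ∣ φ ⟩ ≈ ⟨ ψ′ ∣ φ′ ⟩
  ⟨⟩-cong ψ≈ φ≈ = ∑-cong (λ b → *-cong (conj-cong (ψ≈ b)) (φ≈ b))

  ⟨⟩-congʳ : (ψ : State) {φ φ′ : State} → φ ≈ₛ φ′ → ⟨ ψ ∣ φ ⟩ ≈ ⟨ ψ ∣ φ′ ⟩
  ⟨⟩-congʳ ψ φ≈ = ∑-cong (λ b → *-congˡ (φ≈ b))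

  ⟨⟩-+ : (ψ φ χ : State) → ⟨ ψ ∣ (λ b → φ b + χ b) ⟩ ≈ ⟨ ψ ∣ φ ⟩ + ⟨ ψ ∣ χ ⟩
  ⟨⟩-+ ψ φ χ = trans (∑-cong (λ b → distribˡ (conj (ψ b)) (φ b) (χ b)))
                     (∑-+ (λ b → conj (ψ b) * φ b) (λ b → conj (ψ b) * χ b))

  ⟨⟩-0 : (ψ : State) {φ : State} → φ ≈ₛ (λ _ → 0#) → ⟨ ψ ∣ φ ⟩ ≈ 0#
  ⟨⟩-0 ψ φ≈0 = trans (∑-cong (λ b → trans (*-congˡ (φ≈0 b)) (zeroʳ (conj (ψ b))))) ∑-0

  ⟨⟩-conj : (ψ φ : State) → conj ⟨ ψ ∣ φ ⟩ ≈ ⟨ φ ∣ ψ ⟩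
  ⟨⟩-conj ψ φ = begin
    conj ⟨ ψ ∣ φ ⟩                               ≈⟨ conj-∑ (λ b → conj (ψ b) * φ b) ⟩
    ∑ (λ b → conj (conj (ψ b) * φ b))            ≈⟨ ∑-cong (λ b → conj-* (conj (ψ b)) (φ b)) ⟩
    ∑ (λ b → conj (conj (ψ b)) * conj (φ b))     ≈⟨ ∑-cong (λ b → *-congʳ (conj-involutive (ψ b))) ⟩
    ∑ (λ b → ψ b * conj (φ b))                   ≈⟨ ∑-cong (λ b → *-comm (ψ b) (conj (φ b))) ⟩
    ⟨ φ ∣ ψ ⟩                                     ∎

  ⟨⟩-sym-0 : (ψ φ : State) → ⟨ ψ ∣ φ ⟩ ≈ 0# → ⟨ φ ∣ ψ ⟩ ≈ 0#
  ⟨⟩-sym-0 ψ φ eq = trans (sym (⟨⟩-conj ψ φ)) (trans (conj-cong eq) conj-0)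

  adjoint : (A : Operator) (ψ φ : State) → ⟨ A · ψ ∣ φ ⟩ ≈ ⟨ ψ ∣ A † · φ ⟩
  adjoint A ψ φ = begin
    ∑ (λ b → conj (∑ (λ c → A b c * ψ c)) * φ b)           ≈⟨ ∑-cong expand ⟩
    ∑ (λ b → ∑ (λ c → φ b * (conj (A b c) * conj (ψ c))))  ≈⟨ ∑-swap (λ b c → φ b * (conj (A b c) * conj (ψ c))) ⟩
    ∑ (λ c → ∑ (λ b → φ b * (conj (A b c) * conj (ψ c))))
      ≈⟨ ∑-cong (λ c → ∑-cong (λ b →
           solve 3 (λ x y z → x :* (y :* z) := z :* (y :* x)) refl (φ b) (conj (A b c)) (conj (ψ c)))) ⟩
    ∑ (λ c → ∑ (λ b → conj (ψ c) * (conj (A b c) * φ b)))  ≈⟨ ∑-cong (λ c → *-∑ (conj (ψ c)) (λ b → conj (A b c) * φ b)) ⟨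
    ⟨ ψ ∣ A † · φ ⟩                                         ∎
    where
    expand : ∀ b → conj (∑ (λ c → A b c * ψ c)) * φ b ≈ ∑ (λ c → φ b * (conj (A b c) * conj (ψ c)))
    expand b = begin
      conj (∑ (λ c → A b c * ψ c)) * φ b              ≈⟨ *-comm _ (φ b) ⟩
      φ b * conj (∑ (λ c → A b c * ψ c))              ≈⟨ *-congˡ (conj-∑ (λ c → A b c * ψ c)) ⟩
      φ b * ∑ (λ c → conj (A b c * ψ c))              ≈⟨ *-congˡ (∑-cong (λ c → conj-* (A b c) (ψ c))) ⟩
      φ b * ∑ (λ c → conj (A b c) * conj (ψ c))       ≈⟨ *-∑ (φ b) (λ c → conj (A b c) * conj (ψ c)) ⟩
      ∑ (λ c → φ b * (conj (A b c) * conj (ψ c)))     ∎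

  isometry : (U : Operator) → U † ⊡ U ≋ 𝟙 → (ψ φ : State) → ⟨ U · ψ ∣ U · φ ⟩ ≈ ⟨ ψ ∣ φ ⟩
  isometry U U†U≋𝟙 ψ φ = begin
    ⟨ U · ψ ∣ U · φ ⟩          ≈⟨ adjoint U ψ (U · φ) ⟩
    ⟨ ψ ∣ U † · (U · φ) ⟩      ≈⟨ ⟨⟩-congʳ ψ (·-assoc (U †) U φ) ⟨
    ⟨ ψ ∣ (U † ⊡ U) · φ ⟩      ≈⟨ ⟨⟩-congʳ ψ (·-cong U†U≋𝟙 (λ _ → refl)) ⟩
    ⟨ ψ ∣ 𝟙 · φ ⟩              ≈⟨ ⟨⟩-congʳ ψ (𝟙-· φ) ⟩
    ⟨ ψ ∣ φ ⟩                  ∎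

  record IsProjector (P : Operator) : Set ℓ where
    field
      selfAdjoint : P † ≋ P
      idempotent  : P ⊡ P ≋ P

    symmetric : (ψ φ : State) → ⟨ P · ψ ∣ φ ⟩ ≈ ⟨ ψ ∣ P · φ ⟩
    symmetric ψ φ = trans (adjoint P ψ φ) (⟨⟩-congʳ ψ (·-cong selfAdjoint (λ _ → refl)))

    ·-idem : (ψ : State) → P · P · ψ ≈ₛ P · ψ
    ·-idem ψ b = trans (sym (·-assoc P P ψ b)) (·-cong idempotent (λ _ → refl) b)

    -- Turns the squared norm of a projected state, a measurement probability, into an expectation
    -- value, which is additive in `P`.
    ⟨⟩-projected : (ψ : State) → ⟨ ψ ∣ P · ψ ⟩ ≈ ⟨ P · ψ ∣ P · ψ ⟩
    ⟨⟩-projected ψ = trans (⟨⟩-congʳ ψ (λ b → sym (·-idem ψ b))) (sym (symmetric ψ (P · ψ)))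

  module Complement {P : Operator} (isProjector : IsProjector P) where
    open IsProjector isProjector

    complement : Operator
    complement b c = 𝟙 b c - P b c

    complement-· : (ψ : State) → complement · ψ ≈ₛ λ b → ψ b - (P · ψ) b
    complement-· ψ b = begin
      ∑ (λ c → (𝟙 b c - P b c) * ψ c)
        ≈⟨ ∑-cong (λ c → solve 3 (λ x y z → (x :- y) :* z := x :* z :+ (:- :1) :* (y :* z)) refl (𝟙 b c) (P b c) (ψ c)) ⟩
      ∑ (λ c → 𝟙 b c * ψ c + (- 1#) * (P b c * ψ c))
        ≈⟨ ∑-+ (λ c → 𝟙 b c * ψ c) (λ c → (- 1#) * (P b c * ψ c)) ⟩
      (𝟙 · ψ) b + ∑ (λ c → (- 1#) * (P b c * ψ c))
        ≈⟨ +-cong (𝟙-· ψ b) (sym (*-∑ (- 1#) (λ c → P b c * ψ c))) ⟩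
      ψ b + (- 1#) * (P · ψ) b
        ≈⟨ solve 2 (λ x y → x :+ (:- :1) :* y := x :- y) refl (ψ b) ((P · ψ) b) ⟩
      ψ b - (P · ψ) b ∎

    -- A product applies its left factor to each column of the right one, and this holds by
    -- definition: `(A ⊡ B) b c` unfolds to `(A · (λ d → B d c)) b`. Product identities here and
    -- below thus reduce to the action on states; column `c` of `𝟙` is `ket c`.
    ⊡-complement : ∀ b c → (P ⊡ complement) b c ≈ 0#
    ⊡-complement b c = begin
      (P · (λ d → ket c d - P d c)) b       ≈⟨ ·-- P (ket c) (λ d → P d c) b ⟩
      (P · ket c) b - (P ⊡ P) b c           ≈⟨ +-cong (·-ket P c b) (-‿cong (idempotent b c)) ⟩
      P b c - P b c                         ≈⟨ -‿inverseʳ (P b c) ⟩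
      0#                                    ∎

    complement-⊡ : ∀ b c → (complement ⊡ P) b c ≈ 0#
    complement-⊡ b c = begin
      (complement · (λ d → P d c)) b  ≈⟨ complement-· (λ d → P d c) b ⟩
      P b c - (P ⊡ P) b c             ≈⟨ +-congˡ (-‿cong (idempotent b c)) ⟩
      P b c - P b c                   ≈⟨ -‿inverseʳ (P b c) ⟩
      0#                              ∎

    complement-isProjector : IsProjector complement
    complement-isProjector = record
      { selfAdjoint = λ b c → begin
          conj (ket b c - P c b)              ≈⟨ conj-+ (ket b c) (- P c b) ⟩
          conj (ket b c) + conj (- P c b)     ≈⟨ +-cong (conj-ket b c) (conj-neg (P c b)) ⟩
          ket b c - conj (P c b)              ≈⟨ +-cong (reflexive (ket-sym b c)) (-‿cong (selfAdjoint b c)) ⟩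
          ket c b - P b c                     ∎
      ; idempotent = λ b c → begin
          (complement · (λ d → complement d c)) b   ≈⟨ complement-· (λ d → complement d c) b ⟩
          complement b c - (P ⊡ complement) b c     ≈⟨ +-congˡ (-‿cong (⊡-complement b c)) ⟩
          complement b c - 0#                       ≈⟨ solve 1 (λ x → x :- :0 := x) refl (complement b c) ⟩
          complement b c                            ∎
      }

    complement-complete : ∀ b c → P b c + complement b c ≈ 𝟙 b c
    complement-complete b c = solve 2 (λ x y → x :+ (y :- x) := y) refl (P b c) (𝟙 b c)

  -- One Gram–Schmidt step: adding s ∣v⟩⟨v∣ with v = u − P u and s = 1 / ⟨v∣v⟩
  -- enlarges the range of P by u.
  module Extension {P : Operator} (isProjector : IsProjector P) (u : State)
    {s : Carrier} (conj-s : conj s ≈ s) where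
    open IsProjector isProjector

    v : State
    v b = u b - (P · u) b

    extension : Operator
    extension b c = P b c + s * (v b * conj (v c))

    extension-· : (ψ : State) → extension · ψ ≈ₛ λ b → (P · ψ) b + s * ⟨ v ∣ ψ ⟩ * v b
    extension-· ψ b = begin
      ∑ (λ c → (P b c + s * (v b * conj (v c))) * ψ c)
        ≈⟨ ∑-cong (λ c → solve 5 (λ p s x y z → (p :+ s :* (x :* y)) :* z := p :* z :+ s :* x :* (y :* z)) refl
             (P b c) s (v b) (conj (v c)) (ψ c)) ⟩
      ∑ (λ c → P b c * ψ c + s * v b * (conj (v c) * ψ c))
        ≈⟨ ∑-+ (λ c → P b c * ψ c) (λ c → s * v b * (conj (v c) * ψ c)) ⟩
      (P · ψ) b + ∑ (λ c → s * v b * (conj (v c) * ψ c))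
        ≈⟨ +-congˡ (*-∑ (s * v b) (λ c → conj (v c) * ψ c)) ⟨
      (P · ψ) b + s * v b * ⟨ v ∣ ψ ⟩
        ≈⟨ +-congˡ (solve 3 (λ s x y → s :* x :* y := s :* y :* x) refl s (v b) ⟨ v ∣ ψ ⟩) ⟩
      (P · ψ) b + s * ⟨ v ∣ ψ ⟩ * v b ∎

    P-v : P · v ≈ₛ λ _ → 0#
    P-v b = begin
      (P · v) b                        ≈⟨ ·-- P u (P · u) b ⟩
      (P · u) b - (P · P · u) b        ≈⟨ +-congˡ (-‿cong (·-idem u b)) ⟩
      (P · u) b - (P · u) b            ≈⟨ -‿inverseʳ ((P · u) b) ⟩
      0#                               ∎

    -- `v` lies in the kernel of `P`, and the kernel of a symmetric operator is orthogonal to its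
    -- range.
    v⊥P : (ψ : State) → ⟨ v ∣ P · ψ ⟩ ≈ 0#
    v⊥P ψ = trans (sym (symmetric v ψ)) (⟨⟩-sym-0 ψ (P · v) (⟨⟩-0 ψ P-v))

    u-split : u ≈ₛ λ b → v b + (P · u) b
    u-split b = solve 2 (λ x y → x := (x :- y) :+ y) refl (u b) ((P · u) b)

    extension-fixes-old : {ψ : State} → P · ψ ≈ₛ ψ → extension · ψ ≈ₛ ψ
    extension-fixes-old {ψ} Pψ≈ψ b = begin
      (extension · ψ) b                  ≈⟨ extension-· ψ b ⟩
      (P · ψ) b + s * ⟨ v ∣ ψ ⟩ * v b    ≈⟨ +-cong (Pψ≈ψ b) (*-congʳ (*-congˡ v⊥ψ)) ⟩
      ψ b + s * 0# * v b                 ≈⟨ solve 3 (λ x s v → x :+ s :* :0 :* v := x) refl (ψ b) s (v b) ⟩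
      ψ b                                ∎
      where
      v⊥ψ : ⟨ v ∣ ψ ⟩ ≈ 0#
      v⊥ψ = trans (⟨⟩-congʳ v (λ b → sym (Pψ≈ψ b))) (v⊥P ψ)

    -- Only ψ ⊥ v is missing. As v = u - P u, it follows from ψ ⊥ u and from ⟨ψ∣P u⟩ = ⟨P ψ∣u⟩ = 0.
    extension-kills : {ψ : State} → P · ψ ≈ₛ (λ _ → 0#) → ⟨ u ∣ ψ ⟩ ≈ 0# → extension · ψ ≈ₛ λ _ → 0#
    extension-kills {ψ} Pψ≈0 u⊥ψ b = begin
      (extension · ψ) b                  ≈⟨ extension-· ψ b ⟩
      (P · ψ) b + s * ⟨ v ∣ ψ ⟩ * v b    ≈⟨ +-cong (Pψ≈0 b) (*-congʳ (*-congˡ (⟨⟩-sym-0 ψ v ψ⊥v))) ⟩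
      0# + s * 0# * v b                  ≈⟨ solve 2 (λ s v → :0 :+ s :* :0 :* v := :0) refl s (v b) ⟩
      0#                                 ∎
      where
      ψ⊥v : ⟨ ψ ∣ v ⟩ ≈ 0#
      ψ⊥v = begin
        ⟨ ψ ∣ v ⟩                      ≈⟨ solve 2 (λ x y → x := x :+ y :- y) refl ⟨ ψ ∣ v ⟩ ⟨ ψ ∣ P · u ⟩ ⟩
        ⟨ ψ ∣ v ⟩ + ⟨ ψ ∣ P · u ⟩ - ⟨ ψ ∣ P · u ⟩
          ≈⟨ +-cong (trans (sym (⟨⟩-+ ψ v (P · u))) (⟨⟩-congʳ ψ (λ b → sym (u-split b))))
               (-‿cong (sym (symmetric ψ u))) ⟩
        ⟨ ψ ∣ u ⟩ - ⟨ P · ψ ∣ u ⟩      ≈⟨ +-cong (⟨⟩-sym-0 u ψ u⊥ψ) (-‿cong (⟨⟩-sym-0 u (P · ψ) (⟨⟩-0 u Pψ≈0))) ⟩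
        0# - 0#                        ≈⟨ -‿inverseʳ 0# ⟩
        0#                             ∎

    module _ (s⟨v∣v⟩≈1 : s * ⟨ v ∣ v ⟩ ≈ 1#) where

      -- `P` reproduces the part P u of `u`. Because v ⊥ P u, the coefficient of `u` along `v` is
      -- that of `v` itself, so the new term supplies the missing part.
      extension-fixes-new : extension · u ≈ₛ u
      extension-fixes-new b = begin
        (extension · u) b                 ≈⟨ extension-· u b ⟩
        (P · u) b + s * ⟨ v ∣ u ⟩ * v b   ≈⟨ +-congˡ (*-congʳ (*-congˡ ⟨v∣u⟩)) ⟩
        (P · u) b + s * ⟨ v ∣ v ⟩ * v b   ≈⟨ +-congˡ (*-congʳ s⟨v∣v⟩≈1) ⟩
        (P · u) b + 1# * v b              ≈⟨ solve 2 (λ p x → p :+ :1 :* (x :- p) := x) refl ((P · u) b) (u b) ⟩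
        u b                               ∎
        where
        ⟨v∣u⟩ : ⟨ v ∣ u ⟩ ≈ ⟨ v ∣ v ⟩
        ⟨v∣u⟩ = begin
          ⟨ v ∣ u ⟩                  ≈⟨ ⟨⟩-congʳ v u-split ⟩
          ⟨ v ∣ (λ b → v b + (P · u) b) ⟩ ≈⟨ ⟨⟩-+ v v (P · u) ⟩
          ⟨ v ∣ v ⟩ + ⟨ v ∣ P · u ⟩  ≈⟨ +-congˡ (v⊥P u) ⟩
          ⟨ v ∣ v ⟩ + 0#             ≈⟨ +-identityʳ ⟨ v ∣ v ⟩ ⟩
          ⟨ v ∣ v ⟩                  ∎

      extension-v : extension · v ≈ₛ v
      extension-v b = begin
        (extension · v) b                 ≈⟨ extension-· v b ⟩
        (P · v) b + s * ⟨ v ∣ v ⟩ * v b   ≈⟨ +-cong (P-v b) (*-congʳ s⟨v∣v⟩≈1) ⟩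
        0# + 1# * v b                     ≈⟨ solve 1 (λ x → :0 :+ :1 :* x := x) refl (v b) ⟩
        v b                               ∎

      extension-isProjector : IsProjector extension
      extension-isProjector = record
        { selfAdjoint = λ b c → begin
            conj (P c b + s * (v c * conj (v b)))
              ≈⟨ trans (conj-+ _ _) (+-congˡ (trans (conj-* _ _) (*-congˡ (conj-* _ _)))) ⟩
            conj (P c b) + conj s * (conj (v c) * conj (conj (v b)))
              ≈⟨ +-cong (selfAdjoint b c) (*-cong conj-s (*-congˡ (conj-involutive (v b)))) ⟩
            P b c + s * (conj (v c) * v b)
              ≈⟨ +-congˡ (*-congˡ (*-comm (conj (v c)) (v b))) ⟩
            P b c + s * (v b * conj (v c)) ∎
        -- Column `c` of the extension is column `c` of `P` plus a multiple of `v`, and the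
        -- extension fixes both summands.
        ; idempotent = λ b c → begin
            (extension · (λ d → P d c + s * (v d * conj (v c)))) b
              ≈⟨ ·-congˡ extension (λ d → +-congˡ (rearrange (v d) (conj (v c)))) b ⟩
            (extension · (λ d → P d c + s * conj (v c) * v d)) b
              ≈⟨ ·-+ extension (λ d → P d c) (λ d → s * conj (v c) * v d) b ⟩
            (extension · (λ d → P d c)) b + (extension · (λ d → s * conj (v c) * v d)) b
              ≈⟨ +-cong (extension-fixes-old (λ d → idempotent d c) b) (·-* extension (s * conj (v c)) v b) ⟩
            P b c + s * conj (v c) * (extension · v) b
              ≈⟨ +-congˡ (*-congˡ (extension-v b)) ⟩
            P b c + s * conj (v c) * v b
              ≈⟨ +-congˡ (rearrange (v b) (conj (v c))) ⟨
            P b c + s * (v b * conj (v c)) ∎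
        }
        where
        rearrange : ∀ x y → s * (x * y) ≈ s * y * x
        rearrange x y = solve 3 (λ s x y → s :* (x :* y) := s :* y :* x) refl s x y

  -- Positive definiteness of ⟨_∣_⟩ in the form that Gram–Schmidt consumes.
  Definite : Set _
  Definite = (v : State) → v ≈ₛ (λ _ → 0#) ⊎ ∃[ s ] conj s ≈ s × s * ⟨ v ∣ v ⟩ ≈ 1#

  -- The orthogonal projection onto a span, described without subspaces: `fixes` places the
  -- generators in its range, and `kills` places their orthogonal complement in its kernel.
  record SpanProjector {X : Set} (g : X → State) (xs : List X) : Set (c ⊔ ℓ) where
    field
      operator    : Operator
      isProjector : IsProjector operator
      fixes       : ∀ {x} → x ∈ xs → operator · g x ≈ₛ g x
      kills       : ∀ {w} → (∀ {x} → x ∈ xs → ⟨ g x ∣ w ⟩ ≈ 0#) → operator · w ≈ₛ λ _ → 0#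

  spanProjector : Definite → {X : Set} (g : X → State) (xs : List X) → SpanProjector g xs
  spanProjector definite g [] = record
    { operator    = λ _ _ → 0#
    ; isProjector = record
      { selfAdjoint = λ _ _ → conj-0
      ; idempotent  = λ _ c → 0-· (λ _ → 0#)
      }
    ; fixes       = λ ()
    ; kills       = λ {w} _ _ → 0-· w
    }
    where
    0-· : (ψ : State) → ∑ (λ c → 0# * ψ c) ≈ 0#
    0-· ψ = trans (∑-cong (λ c → zeroˡ (ψ c))) ∑-0
  spanProjector definite g (x ∷ xs) with spanProjector definite g xs
  ... | span with definite (λ b → g x b - (SpanProjector.operator span · g x) b)
  -- The new generator depends linearly on the earlier ones; it is already fixed, and the projector
  -- stays as it is.
  ...   | inj₁ v≈0 = record
    { operator    = operator
    ; isProjector = isProjector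
    ; fixes       = λ
      { (here ≡.refl) b → begin
          (operator · g x) b                        ≈⟨ +-identityˡ _ ⟨
          0# + (operator · g x) b                   ≈⟨ +-congʳ (v≈0 b) ⟨
          g x b - (operator · g x) b + (operator · g x) b ≈⟨ solve 2 (λ x y → x :- y :+ y := x) refl (g x b) _ ⟩
          g x b                                     ∎
      ; (there y∈xs) → fixes y∈xs
      }
    ; kills       = λ ⊥w → kills (λ y∈xs → ⊥w (there y∈xs))
    }
    where open SpanProjector span
  ...   | inj₂ (s , conj-s , s⟨v∣v⟩≈1) = record
    { operator    = extension
    ; isProjector = extension-isProjector s⟨v∣v⟩≈1
    ; fixes       = λ
      { (here ≡.refl) → extension-fixes-new s⟨v∣v⟩≈1
      ; (there y∈xs)  → extension-fixes-old (fixes y∈xs)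
      }
    ; kills       = λ ⊥w → extension-kills (kills (λ y∈xs → ⊥w (there y∈xs))) (⊥w (here ≡.refl))
    }
    where
    open SpanProjector span
    open Extension isProjector (g x) conj-s

-- The complex numbers as a commutative ring with conjugation and modulus

module ComplexProperties (ℝ : CompleteOrderedField) where
  open CompleteOrderedField ℝ
  open Complex ℝ
  open OrderedFieldProperties ℝ
  private
    module ℝᵣ = CommutativeRing commutativeRing
    open ℝᵣ using (refl; sym; trans; +-cong; *-cong; -‿cong)
    open IntegerCoefficientSolver commutativeRing
    module ℂᵣ = RawRing ℂ-rawRing

  ℂ-isCommutativeRing : IsCommutativeRing ℂᵣ._≈_ ℂᵣ._+_ ℂᵣ._*_ ℂᵣ.-_ ℂᵣ.0# ℂᵣ.1#
  ℂ-isCommutativeRing = record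
    { isRing = record
      { +-isAbelianGroup = record
        { isGroup = record
          { isMonoid = record
            { isSemigroup = record
              { isMagma = record
                { isEquivalence = record
                  { refl  = refl , refl
                  ; sym   = λ (p , q) → sym p , sym q
                  ; trans = λ (p , q) (p′ , q′) → trans p p′ , trans q q′
                  }
                ; ∙-cong = λ (p , q) (p′ , q′) → +-cong p p′ , +-cong q q′
                }
              ; assoc = λ z w v → ℝᵣ.+-assoc _ _ _ , ℝᵣ.+-assoc _ _ _
              }
            ; identity = (λ z → ℝᵣ.+-identityˡ _ , ℝᵣ.+-identityˡ _)
                       , (λ z → ℝᵣ.+-identityʳ _ , ℝᵣ.+-identityʳ _)
            }
          ; inverse = (λ z → ℝᵣ.-‿inverseˡ _ , ℝᵣ.-‿inverseˡ _)
                    , (λ z → ℝᵣ.-‿inverseʳ _ , ℝᵣ.-‿inverseʳ _)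
          ; ⁻¹-cong = λ (p , q) → -‿cong p , -‿cong q
          }
        ; comm = λ z w → ℝᵣ.+-comm _ _ , ℝᵣ.+-comm _ _
        }
      ; *-cong = λ (p , q) (p′ , q′) →
          +-cong (*-cong p p′) (-‿cong (*-cong q q′)) , +-cong (*-cong p q′) (*-cong q p′)
      ; *-assoc = λ z w v →
          solve 6 (λ a b c d e f → (a :* c :- b :* d) :* e :- (a :* d :+ b :* c) :* f
                                := a :* (c :* e :- d :* f) :- b :* (c :* f :+ d :* e))
            refl (re z) (im z) (re w) (im w) (re v) (im v)
        , solve 6 (λ a b c d e f → (a :* c :- b :* d) :* f :+ (a :* d :+ b :* c) :* e
                                := a :* (c :* f :+ d :* e) :+ b :* (c :* e :- d :* f))
            refl (re z) (im z) (re w) (im w) (re v) (im v)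
      ; *-identity = (λ z →
          solve 2 (λ a b → :1 :* a :- :0 :* b := a) refl (re z) (im z)
        , solve 2 (λ a b → :1 :* b :+ :0 :* a := b) refl (re z) (im z))
        , λ z →
          solve 2 (λ a b → a :* :1 :- b :* :0 := a) refl (re z) (im z)
        , solve 2 (λ a b → a :* :0 :+ b :* :1 := b) refl (re z) (im z)
      ; distrib = (λ z w v →
          solve 6 (λ a b c d e f → a :* (c :+ e) :- b :* (d :+ f)
                                := (a :* c :- b :* d) :+ (a :* e :- b :* f))
            refl (re z) (im z) (re w) (im w) (re v) (im v)
        , solve 6 (λ a b c d e f → a :* (d :+ f) :+ b :* (c :+ e)
                                := (a :* d :+ b :* c) :+ (a :* f :+ b :* e))
            refl (re z) (im z) (re w) (im w) (re v) (im v))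
        , λ z w v →
          solve 6 (λ a b c d e f → (c :+ e) :* a :- (d :+ f) :* b
                                := (c :* a :- d :* b) :+ (e :* a :- f :* b))
            refl (re z) (im z) (re w) (im w) (re v) (im v)
        , solve 6 (λ a b c d e f → (c :+ e) :* b :+ (d :+ f) :* a
                                := (c :* b :+ d :* a) :+ (e :* b :+ f :* a))
            refl (re z) (im z) (re w) (im w) (re v) (im v)
      }
    ; *-comm = λ z w →
        solve 4 (λ a b c d → a :* c :- b :* d := c :* a :- d :* b) refl (re z) (im z) (re w) (im w)
      , solve 4 (λ a b c d → a :* d :+ b :* c := c :* b :+ d :* a) refl (re z) (im z) (re w) (im w)
    }

  ℂ-commutativeRing : CommutativeRing _ _
  ℂ-commutativeRing = record { isCommutativeRing = ℂ-isCommutativeRing }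

  real : Carrier → ℂ
  real x = x +i 0#

  private
    open module ℂSum = SemiringSum (CommutativeRing.semiring ℂ-commutativeRing) using () renaming (sum to sumᶜ)

  real-cong : ∀ {x y} → x ≈ y → real x ℂᵣ.≈ real y
  real-cong x≈y = x≈y , refl

  real-+ : ∀ x y → real (x + y) ℂᵣ.≈ real x ℂᵣ.+ real y
  real-+ x y = refl , sym (ℝᵣ.+-identityˡ 0#)

  real-* : ∀ x y → real (x * y) ℂᵣ.≈ real x ℂᵣ.* real y
  real-* x y = solve 2 (λ x y → x :* y := x :* y :- :0 :* :0) refl x y
             , solve 2 (λ x y → :0 := x :* :0 :+ :0 :* y) refl x y

  real-sum : ∀ {n} (f : Fin n → Carrier) → real (sum f) ℂᵣ.≈ sumᶜ (λ i → real (f i))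
  real-sum {zero}  f = refl , refl
  real-sum {suc n} f = trans (proj₁ h) (+-cong refl (proj₁ t)) , trans (proj₂ h) (+-cong refl (proj₂ t))
    where
    h = real-+ (f zero) (sum (λ i → f (suc i)))
    t = real-sum (λ i → f (suc i))

  conj-real : ∀ x → conj (real x) ℂᵣ.≈ real x
  conj-real x = refl , solve 0 (:- :0 := :0) refl

  conjugation : Conjugation ℂ-commutativeRing
  conjugation = record
    { conj            = conj
    ; conj-cong       = λ (p , q) → p , -‿cong q
    ; conj-+          = λ z w → refl , solve 2 (λ b d → :- (b :+ d) := :- b :+ :- d) refl (im z) (im w)
    ; conj-*          = λ z w →
          solve 4 (λ a b c d → a :* c :- b :* d := a :* c :- (:- b) :* (:- d)) refl (re z) (im z) (re w) (im w)
        , solve 4 (λ a b c d → :- (a :* d :+ b :* c) := a :* (:- d) :+ (:- b) :* c) refl (re z) (im z) (re w) (im w)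
    ; conj-neg        = λ z → refl , refl
    ; conj-0          = conj-real 0#
    ; conj-1          = conj-real 1#
    ; conj-involutive = λ z → refl , solve 1 (λ b → :- (:- b) := b) refl (im z)
    }

  conj-*-self : ∀ z → conj z ℂᵣ.* z ℂᵣ.≈ real ∣ z ∣²
  conj-*-self z =
      solve 2 (λ a b → a :* a :- (:- b) :* b := a :* a :+ b :* b) refl (re z) (im z)
    , solve 2 (λ a b → a :* b :+ (:- b) :* a := :0) refl (re z) (im z)

  ∣∣²-cong : ∀ {z w} → z ℂᵣ.≈ w → ∣ z ∣² ≈ ∣ w ∣²
  ∣∣²-cong (p , q) = +-cong (*-cong p p) (*-cong q q)

  ∣∣²-nonNeg : ∀ z → 0# ≤ ∣ z ∣²
  ∣∣²-nonNeg z = +-nonNeg (square-nonNeg (re z)) (square-nonNeg (im z))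

  ∣∣²-zero : ∀ {z} → ∣ z ∣² ≈ 0# → z ℂᵣ.≈ ℂᵣ.0#
  ∣∣²-zero {z} eq =
      square-zero (+-nonNeg-zeroˡ (square-nonNeg (re z)) (square-nonNeg (im z)) eq)
    , square-zero (+-nonNeg-zeroˡ (square-nonNeg (im z)) (square-nonNeg (re z)) (trans (ℝᵣ.+-comm _ _) eq))

-- A finite list of all inputs, from which the generators of the span are selected

bitVectors : ∀ n → List (Vec Bool n)
bitVectors zero    = [ [] ]
bitVectors (suc n) = map (true ∷_) (bitVectors n) ++ map (false ∷_) (bitVectors n)

∈-bitVectors : ∀ {n} (x : Vec Bool n) → x ∈ bitVectors n
∈-bitVectors []          = here ≡.refl
∈-bitVectors (true  ∷ x) = ∈-++⁺ˡ (∈-map⁺ (true ∷_) (∈-bitVectors x))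
∈-bitVectors {suc n} (false ∷ x) = ∈-++⁺ʳ (map (true ∷_) (bitVectors n)) (∈-map⁺ (false ∷_) (∈-bitVectors x))

-- Inner products of final states, exact measurements and the two implications

module QueryStates (ℝ : CompleteOrderedField) where
  open CompleteOrderedField ℝ
  open Quantum ℝ hiding (_≟_)
  open Complex ℝ
  open OrderedFieldProperties ℝ
  open ComplexProperties ℝ
  private
    module ℝᵣ = CommutativeRing commutativeRing
    module ℝΣ = SemiringSum ℝᵣ.semiring
    module ℂᵣ = CommutativeRing ℂ-commutativeRing
    module ℂΣ = SemiringSum ℂᵣ.semiring
    module ℝS = IntegerCoefficientSolver commutativeRing
    module ℂS = IntegerCoefficientSolver ℂ-commutativeRing
    module ℝR = SetoidReasoning ℝᵣ.setoid
    module ℂR = SetoidReasoning ℂᵣ.setoid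
    module L n m = LinearAlgebra ℂ-commutativeRing conjugation (suc n) m

  -- The product of `∣F(x ⊕ y)⟩₁` with β, unfolding to the expression in the theorem. The term
  -- `β zero` belongs to query index 0, where the oracle acts trivially, and so bears no sign.
  correlation : ∀ {n} → Vector Carrier (suc n) → Vec Bool n → Vec Bool n → Carrier
  correlation β x y = β zero + sum (λ i → β (suc i) * sign (lookup x i xor lookup y i))

  sign-xor : ∀ a b → sign a * sign b ≈ sign (a xor b)
  sign-xor true  true  = ℝS.solve 0 ((ℝS.:- ℝS.:1) ℝS.:* (ℝS.:- ℝS.:1) ℝS.:= ℝS.:1) ℝᵣ.refl
  sign-xor true  false = ℝᵣ.*-identityʳ (- 1#)
  sign-xor false b     = ℝᵣ.*-identityˡ (sign b)

  correlation-cong : ∀ {n} {β γ : Vector Carrier (suc n)} → (∀ i → β i ≈ γ i) →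
    ∀ x y → correlation β x y ≈ correlation γ x y
  correlation-cong β≈γ x y = ℝᵣ.+-cong (β≈γ zero) (ℝΣ.sum-cong-≋ (λ i → ℝᵣ.*-congʳ (β≈γ (suc i))))

  correlation-self : ∀ {n} (β : Vector Carrier (suc n)) x → correlation β x x ≈ sum β
  correlation-self β x = ℝᵣ.+-congˡ (ℝΣ.sum-cong-≋ (λ i →
    ℝᵣ.trans (ℝᵣ.*-congˡ (ℝᵣ.reflexive (≡.cong sign (Bool.xor-same (lookup x i))))) (ℝᵣ.*-identityʳ (β (suc i)))))

  phaseSign : ∀ {n} → Vec Bool n → Fin (suc n) → Carrier
  phaseSign x zero    = 1#
  phaseSign x (suc k) = sign (lookup x k)

  phase≈ : ∀ {n m} (x : Vec Bool n) i → phase {n} {m} x i ℂᵣ.≈ real (phaseSign x i)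
  phase≈ x zero    = ℂᵣ.refl
  phase≈ x (suc k) with lookup x k
  -- Negation in ℂ acts on both components, so the phase has imaginary part - 0 instead of 0.
  ... | true  = ℝᵣ.refl , ℝS.solve 0 (ℝS.:- ℝS.:0 ℝS.:= ℝS.:0) ℝᵣ.refl
  ... | false = ℂᵣ.refl

  module _ {n m : ℕ} where
    open L n m using (_≈ₛ_; ⟨_∣_⟩)

    weight : State {n} {m} → Vector Carrier (suc n)
    weight ψ i = sum (λ j → ∣ ψ (i , j) ∣²)

    weight-cong : {ψ φ : State {n} {m}} → ψ ≈ₛ φ → ∀ i → weight ψ i ≈ weight φ i
    weight-cong ψ≈φ i = ℝΣ.sum-cong-≋ (λ j → ∣∣²-cong (ψ≈φ (i , j)))

    weight-nonNeg : (ψ : State {n} {m}) → ∀ i → 0# ≤ weight ψ i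
    weight-nonNeg ψ i = sum-nonNeg _ (λ j → ∣∣²-nonNeg (ψ (i , j)))

    ∥∥²-cong : {ψ φ : State {n} {m}} → ψ ≈ₛ φ → ∥ ψ ∥² ≈ ∥ φ ∥²
    ∥∥²-cong ψ≈φ = ℝΣ.sum-cong-≋ (weight-cong ψ≈φ)

    ∥∥²-zero : (ψ : State {n} {m}) → ∥ ψ ∥² ≈ 0# → ψ ≈ₛ (λ _ → ℂᵣ.0#)
    ∥∥²-zero ψ eq (i , j) = ∣∣²-zero (sum-nonNeg-zero _ (λ l → ∣∣²-nonNeg (ψ (i , l)))
      (sum-nonNeg-zero (weight ψ) (weight-nonNeg ψ) eq i) j)

    ⟨⟩-self : (ψ : State {n} {m}) → ⟨ ψ ∣ ψ ⟩ ℂᵣ.≈ real ∥ ψ ∥²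
    ⟨⟩-self ψ = begin
      ⟨ ψ ∣ ψ ⟩
        ≈⟨ ℂΣ.sum-cong-≋ (λ i → ℂΣ.sum-cong-≋ (λ j → conj-*-self (ψ (i , j)))) ⟩
      ℂΣ.sum (λ i → ℂΣ.sum (λ j → real ∣ ψ (i , j) ∣²))
        ≈⟨ ℂΣ.sum-cong-≋ (λ i → real-sum (λ j → ∣ ψ (i , j) ∣²)) ⟨
      ℂΣ.sum (λ i → real (weight ψ i))
        ≈⟨ real-sum (weight ψ) ⟨
      real ∥ ψ ∥² ∎
      where open ℂR

    -- The case distinction rests on the decidable equality of the reals. A vanishing sum of squared
    -- moduli makes every entry vanish; any other squared norm has a real inverse, which conjugation
    -- fixes.
    definite : L.Definite n m
    definite v with ∥ v ∥² ≟ 0#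
    ... | yes eq = inj₁ (∥∥²-zero v eq)
    ... | no  ≉0 with inverse ∥ v ∥² ≉0
    ...   | (r , vr≈1) = inj₂ (real r , conj-real r , (begin
      real r ℂᵣ.* ⟨ v ∣ v ⟩     ≈⟨ ℂᵣ.*-congˡ {real r} (⟨⟩-self v) ⟩
      real r ℂᵣ.* real ∥ v ∥²   ≈⟨ real-* r ∥ v ∥² ⟨
      real (r * ∥ v ∥²)         ≈⟨ real-cong (ℝᵣ.trans (ℝᵣ.*-comm r ∥ v ∥²) vr≈1) ⟩
      ℂᵣ.1#                     ∎))
      where open ℂR

    oracle-· : ∀ x (ψ : State {n} {m}) → oracle x · ψ ≈ₛ λ b → real (phaseSign x (proj₁ b)) ℂᵣ.* ψ b
    oracle-· x ψ b = begin
      ∑ (λ c → phase {n} {m} x (proj₁ c) ℂᵣ.* ket c b ℂᵣ.* ψ c)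
        ≈⟨ L.∑-cong n m (λ c → rearrange (phase {n} {m} x (proj₁ c)) (ket c b) (ψ c)) ⟩
      ∑ (λ c → ket c b ℂᵣ.* (phase {n} {m} x (proj₁ c) ℂᵣ.* ψ c))
        ≈⟨ L.𝟙-· n m (λ c → phase {n} {m} x (proj₁ c) ℂᵣ.* ψ c) b ⟩
      phase {n} {m} x (proj₁ b) ℂᵣ.* ψ b
        ≈⟨ ℂᵣ.*-congʳ {ψ b} (phase≈ {m = m} x (proj₁ b)) ⟩
      real (phaseSign x (proj₁ b)) ℂᵣ.* ψ b ∎
      where
      open ℂR
      rearrange : ∀ p k z → p ℂᵣ.* k ℂᵣ.* z ℂᵣ.≈ k ℂᵣ.* (p ℂᵣ.* z)
      rearrange = ℂS.solve 3 (λ p k z → p ℂS.:* k ℂS.:* z ℂS.:= k ℂS.:* (p ℂS.:* z)) ℂᵣ.refl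

    ⟨oracle∣oracle⟩ : ∀ x y (ψ : State {n} {m}) →
      ⟨ oracle x · ψ ∣ oracle y · ψ ⟩ ℂᵣ.≈ real (correlation (weight ψ) x y)
    ⟨oracle∣oracle⟩ x y ψ = begin
      ⟨ oracle x · ψ ∣ oracle y · ψ ⟩
        ≈⟨ L.⟨⟩-cong n m (oracle-· x ψ) (oracle-· y ψ) ⟩
      ℂΣ.sum (λ i → ℂΣ.sum (λ j →
        conj (real (phaseSign x i) ℂᵣ.* ψ (i , j)) ℂᵣ.* (real (phaseSign y i) ℂᵣ.* ψ (i , j))))
        ≈⟨ ℂΣ.sum-cong-≋ (λ i → ℂΣ.sum-cong-≋ (λ j → pointwise (phaseSign x i) (phaseSign y i) (ψ (i , j)))) ⟩
      ℂΣ.sum (λ i → ℂΣ.sum (λ j → real (phaseSign x i * phaseSign y i * ∣ ψ (i , j) ∣²)))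
        ≈⟨ ℂΣ.sum-cong-≋ (λ i → real-sum (λ j → phaseSign x i * phaseSign y i * ∣ ψ (i , j) ∣²)) ⟨
      ℂΣ.sum (λ i → real (sum (λ j → phaseSign x i * phaseSign y i * ∣ ψ (i , j) ∣²)))
        ≈⟨ real-sum (λ i → sum (λ j → phaseSign x i * phaseSign y i * ∣ ψ (i , j) ∣²)) ⟨
      real (sum (λ i → sum (λ j → phaseSign x i * phaseSign y i * ∣ ψ (i , j) ∣²)))
        ≈⟨ real-cong (ℝΣ.sum-cong-≋ (λ i → ℝΣ.*-distribˡ-sum (phaseSign x i * phaseSign y i) (λ j → ∣ ψ (i , j) ∣²))) ⟨
      real (sum (λ i → phaseSign x i * phaseSign y i * weight ψ i))
        -- Index 0 carries the phases 1 and 1; at the other indices the two signs merge into the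
        -- sign of the exclusive or.
        ≈⟨ real-cong (ℝᵣ.+-cong
             (ℝᵣ.trans (ℝᵣ.*-congʳ (ℝᵣ.*-identityˡ 1#)) (ℝᵣ.*-identityˡ (weight ψ zero)))
             (ℝΣ.sum-cong-≋ (λ k → ℝᵣ.trans (ℝᵣ.*-congʳ (sign-xor (lookup x k) (lookup y k)))
                                            (ℝᵣ.*-comm _ (weight ψ (suc k)))))) ⟩
      real (correlation (weight ψ) x y) ∎
      where
      open ℂR
      pointwise : ∀ a b z → conj (real a ℂᵣ.* z) ℂᵣ.* (real b ℂᵣ.* z) ℂᵣ.≈ real (a * b * ∣ z ∣²)
      pointwise a b z = begin
        conj (real a ℂᵣ.* z) ℂᵣ.* (real b ℂᵣ.* z)
          ≈⟨ ℂᵣ.*-congʳ {real b ℂᵣ.* z} (conj-* (real a) z) ⟩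
        conj (real a) ℂᵣ.* conj z ℂᵣ.* (real b ℂᵣ.* z)
          ≈⟨ ℂᵣ.*-congʳ {real b ℂᵣ.* z} (ℂᵣ.*-congʳ {conj z} (conj-real a)) ⟩
        real a ℂᵣ.* conj z ℂᵣ.* (real b ℂᵣ.* z)
          ≈⟨ rearrange (real a) (conj z) (real b) z ⟩
        real a ℂᵣ.* real b ℂᵣ.* (conj z ℂᵣ.* z)
          ≈⟨ ℂᵣ.*-cong (ℂᵣ.sym (real-* a b)) (conj-*-self z) ⟩
        real (a * b) ℂᵣ.* real ∣ z ∣²
          ≈⟨ real-* (a * b) ∣ z ∣² ⟨
        real (a * b * ∣ z ∣²) ∎
        where
        open Conjugation conjugation using (conj-*)
        rearrange : ∀ p q r s → p ℂᵣ.* q ℂᵣ.* (r ℂᵣ.* s) ℂᵣ.≈ p ℂᵣ.* r ℂᵣ.* (q ℂᵣ.* s)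
        rearrange = ℂS.solve 4 (λ p q r s → p ℂS.:* q ℂS.:* (r ℂS.:* s) ℂS.:= p ℂS.:* r ℂS.:* (q ℂS.:* s)) ℂᵣ.refl

    ∥∥²-unitary : {U : Operator {n} {m}} → Unitary U → ∀ ψ → ∥ U · ψ ∥² ≈ ∥ ψ ∥²
    -- Norms are real but inner products live in ℂ, where equality is a pair; its first component
    -- compares the real parts.
    ∥∥²-unitary {U} unitary ψ = proj₁ (begin
      real ∥ U · ψ ∥²    ≈⟨ ⟨⟩-self (U · ψ) ⟨
      ⟨ U · ψ ∣ U · ψ ⟩  ≈⟨ L.isometry n m U (Unitary.U†U≋𝟙 unitary) ψ ψ ⟩
      ⟨ ψ ∣ ψ ⟩          ≈⟨ ⟨⟩-self ψ ⟩
      real ∥ ψ ∥²        ∎)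
      where open ℂR

    ⟨final∣final⟩ : {U₁ : Operator {n} {m}} → Unitary U₁ → ∀ x y ψ →
      ⟨ U₁ · oracle x · ψ ∣ U₁ · oracle y · ψ ⟩ ℂᵣ.≈ real (correlation (weight ψ) x y)
    ⟨final∣final⟩ {U₁} unitary x y ψ =
      ℂᵣ.trans (L.isometry n m U₁ (Unitary.U†U≋𝟙 unitary) (oracle x · ψ) (oracle y · ψ)) (⟨oracle∣oracle⟩ x y ψ)

    -- The inner product formula at y = x, where all signs are 1, takes the place of a proof that
    -- the oracle is unitary.
    ∥final∥² : {U₁ : Operator {n} {m}} → Unitary U₁ → ∀ x ψ → ∥ U₁ · oracle x · ψ ∥² ≈ ∥ ψ ∥²
    ∥final∥² {U₁} unitary x ψ = proj₁ (begin
      real ∥ U₁ · oracle x · ψ ∥²                    ≈⟨ ⟨⟩-self (U₁ · oracle x · ψ) ⟨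
      ⟨ U₁ · oracle x · ψ ∣ U₁ · oracle x · ψ ⟩      ≈⟨ ⟨final∣final⟩ unitary x x ψ ⟩
      real (correlation (weight ψ) x x)              ≈⟨ real-cong (correlation-self (weight ψ) x) ⟩
      real ∥ ψ ∥²                                    ∎)
      where open ℂR

    module Measurement {P : Bool → Operator {n} {m}} (measurement : ProjectiveMeasurement P) where
      open ProjectiveMeasurement measurement

      projector : ∀ b → L.IsProjector n m (P b)
      projector b = record { selfAdjoint = selfAdjoint b ; idempotent = idempotent b }

      resolve : ∀ φ → φ ≈ₛ λ b → (P false · φ) b ℂᵣ.+ (P true · φ) b
      resolve φ b = begin
        φ b                                                    ≈⟨ L.𝟙-· n m φ b ⟨
        (𝟙 · φ) b                                              ≈⟨ L.·-cong n m {ψ = φ} complete (λ _ → ℂᵣ.refl) b ⟨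
        ∑ (λ c → (P false b c ℂᵣ.+ P true b c) ℂᵣ.* φ c)
          ≈⟨ L.∑-cong n m (λ c → ℂᵣ.distribʳ (φ c) (P false b c) (P true b c)) ⟩
        ∑ (λ c → P false b c ℂᵣ.* φ c ℂᵣ.+ P true b c ℂᵣ.* φ c)
          ≈⟨ L.∑-+ n m (λ c → P false b c ℂᵣ.* φ c) (λ c → P true b c ℂᵣ.* φ c) ⟩
        (P false · φ) b ℂᵣ.+ (P true · φ) b                    ∎
        where open ℂR

      -- Splitting only the right argument of ⟨φ∣φ⟩ produces no cross terms, and each ⟨φ∣P b φ⟩ is
      -- already a squared norm.
      pythagoras : ∀ φ → ∥ φ ∥² ≈ ∥ P false · φ ∥² + ∥ P true · φ ∥²
      pythagoras φ = proj₁ (begin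
        real ∥ φ ∥²                                        ≈⟨ ⟨⟩-self φ ⟨
        ⟨ φ ∣ φ ⟩                                          ≈⟨ L.⟨⟩-congʳ n m φ (resolve φ) ⟩
        ⟨ φ ∣ (λ b → (P false · φ) b ℂᵣ.+ (P true · φ) b) ⟩ ≈⟨ L.⟨⟩-+ n m φ (P false · φ) (P true · φ) ⟩
        ⟨ φ ∣ P false · φ ⟩ ℂᵣ.+ ⟨ φ ∣ P true · φ ⟩        ≈⟨ ℂᵣ.+-cong (component false) (component true) ⟩
        real ∥ P false · φ ∥² ℂᵣ.+ real ∥ P true · φ ∥²    ≈⟨ real-+ ∥ P false · φ ∥² ∥ P true · φ ∥² ⟨
        real (∥ P false · φ ∥² + ∥ P true · φ ∥²)          ∎)
        where
        open ℂR
        component : ∀ b → ⟨ φ ∣ P b · φ ⟩ ℂᵣ.≈ real ∥ P b · φ ∥²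
        component b = ℂᵣ.trans (L.IsProjector.⟨⟩-projected n m (projector b) φ) (⟨⟩-self (P b · φ))

      private
        remainder-zero : ∀ {p q r} → r ≈ p + q → p ≈ r → q ≈ 0#
        remainder-zero {p} {q} {r} r≈p+q p≈r = begin
          q            ≈⟨ ℝS.solve 2 (λ p q → q ℝS.:= p ℝS.:+ q ℝS.:- p) ℝᵣ.refl p q ⟩
          p + q - p    ≈⟨ ℝᵣ.+-cong (ℝᵣ.sym r≈p+q) (ℝᵣ.-‿cong p≈r) ⟩
          r - r        ≈⟨ ℝᵣ.-‿inverseʳ r ⟩
          0#           ∎
          where open ℝR

      -- By `pythagoras`, certainty of one outcome annihilates the component of the other: P true φ
      -- = 0 and P false χ = 0. Hence ⟨φ∣χ⟩ = ⟨φ∣P true χ⟩ = ⟨P true φ∣χ⟩ = 0.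
      certain⇒⊥ : ∀ φ χ → ∥ P false · φ ∥² ≈ ∥ φ ∥² → ∥ P true · χ ∥² ≈ ∥ χ ∥² → ⟨ φ ∣ χ ⟩ ℂᵣ.≈ ℂᵣ.0#
      certain⇒⊥ φ χ φ-false χ-true = begin
        ⟨ φ ∣ χ ⟩                                            ≈⟨ L.⟨⟩-congʳ n m φ (resolve χ) ⟩
        ⟨ φ ∣ (λ b → (P false · χ) b ℂᵣ.+ (P true · χ) b) ⟩  ≈⟨ L.⟨⟩-+ n m φ (P false · χ) (P true · χ) ⟩
        ⟨ φ ∣ P false · χ ⟩ ℂᵣ.+ ⟨ φ ∣ P true · χ ⟩
          ≈⟨ ℂᵣ.+-cong (L.⟨⟩-0 n m φ P₀χ≈0) (ℂᵣ.trans (ℂᵣ.sym (L.IsProjector.symmetric n m (projector true) φ χ))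
               (L.⟨⟩-sym-0 n m χ (P true · φ) (L.⟨⟩-0 n m χ P₁φ≈0))) ⟩
        ℂᵣ.0# ℂᵣ.+ ℂᵣ.0#                                     ≈⟨ ℂᵣ.+-identityˡ ℂᵣ.0# ⟩
        ℂᵣ.0#                                                ∎
        where
        open ℂR
        P₁φ≈0 = ∥∥²-zero (P true · φ) (remainder-zero (pythagoras φ) φ-false)
        P₀χ≈0 = ∥∥²-zero (P false · χ)
          (remainder-zero (ℝᵣ.trans (pythagoras χ) (ℝᵣ.+-comm _ _)) χ-true)

    𝟙-unitary : Unitary {n} {m} 𝟙
    𝟙-unitary = record
      { U†U≋𝟙 = λ b c → ℂᵣ.trans (L.·-cong n m {ψ = λ d → 𝟙 d c} 𝟙† (λ _ → ℂᵣ.refl) b) (L.𝟙-· n m (λ d → 𝟙 d c) b)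
      ; UU†≋𝟙 = λ b c → ℂᵣ.trans (L.𝟙-· n m (λ d → (𝟙 †) d c) b) (𝟙† b c)
      }
      where
      𝟙† : 𝟙 † ≋ 𝟙
      𝟙† b c = ℂᵣ.trans (L.conj-ket n m b c) (ℂᵣ.reflexive (L.ket-sym n m b c))

  -- Unfolds to the condition on β in the theorem, so that each implication can be proved on its
  -- own.
  Separating : ∀ {n} → PartialBooleanFunction n → Vector Carrier (suc n) → Set
  Separating {n} f β =
    (∀ (i : Fin (suc n)) → 0# ≤ β i) × sum β ≈ 1# ×
    (∀ (x y : Vec Bool n) → f x ≡ just false → f y ≡ just true → correlation β x y ≈ 0#)

  computable⇒separating : ∀ {n} (f : PartialBooleanFunction n) → OneQueryComputable f → ∃ (Separating f)
  computable⇒separating {n} f (A , exact) =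
    weight ψ , weight-nonNeg ψ , ℝᵣ.trans (∥∥²-unitary U₀-unitary ψ₀) normalised , λ x y fx≡0 fy≡1 →
      proj₁ (ℂᵣ.trans (ℂᵣ.sym (⟨final∣final⟩ U₁-unitary x y ψ))
        (Measurement.certain⇒⊥ measurement (finalState x) (finalState y)
          (certain x (exact x false fx≡0)) (certain y (exact y true fy≡1))))
    where
    open OneQueryAlgorithm A
    ψ = U₀ · ψ₀
    certain : ∀ x {p} → p ≈ 1# → p ≈ ∥ finalState x ∥²
    certain x p≈1 = ℝᵣ.trans p≈1 (ℝᵣ.sym
      (ℝᵣ.trans (∥final∥² U₁-unitary x ψ) (ℝᵣ.trans (∥∥²-unitary U₀-unitary ψ₀) normalised)))

  separating⇒computable : ∀ {n} (f : PartialBooleanFunction n) → ∃ (Separating f) → OneQueryComputable f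
  separating⇒computable {n} f (β , 0≤β , Σβ≈1 , β⊥) = A , exact
    where
    ψ₀ : State {n} {1}
    ψ₀ (i , _) = real (proj₁ (sqrt (0≤β i)))

    -- The identity operators are kept here and in `φ`, so that `φ x` is by definition the final
    -- state of the algorithm `A` built below.
    ψ : State {n} {1}
    ψ = 𝟙 · ψ₀

    φ : Vec Bool n → State {n} {1}
    φ x = 𝟙 · oracle x · ψ

    weight-ψ₀ : ∀ i → weight ψ₀ i ≈ β i
    weight-ψ₀ i = ℝᵣ.trans
      (ℝS.solve 1 (λ s → s ℝS.:* s ℝS.:+ ℝS.:0 ℝS.:* ℝS.:0 ℝS.:+ ℝS.:0 ℝS.:= s ℝS.:* s)
        ℝᵣ.refl (proj₁ (sqrt (0≤β i))))
      (proj₂ (sqrt (0≤β i)))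

    ψ₀-normalised : ∥ ψ₀ ∥² ≈ 1#
    ψ₀-normalised = ℝᵣ.trans (ℝΣ.sum-cong-≋ weight-ψ₀) Σβ≈1

    φ-normalised : ∀ x → ∥ φ x ∥² ≈ 1#
    φ-normalised x = ℝᵣ.trans (∥final∥² 𝟙-unitary x ψ) (ℝᵣ.trans (∥∥²-unitary 𝟙-unitary ψ₀) ψ₀-normalised)

    φ⊥ : ∀ x y → f x ≡ just false → f y ≡ just true → L.⟨_∣_⟩ n 1 (φ x) (φ y) ℂᵣ.≈ ℂᵣ.0#
    φ⊥ x y fx≡0 fy≡1 = ℂᵣ.trans (⟨final∣final⟩ 𝟙-unitary x y ψ) (real-cong (ℝᵣ.trans
      (correlation-cong (λ i → ℝᵣ.trans (weight-cong (L.𝟙-· n 1 ψ₀) i) (weight-ψ₀ i)) x y)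
      (β⊥ x y fx≡0 fy≡1)))

    isFalse? : ∀ x → _
    isFalse? x = Maybe.≡-dec Bool._≟_ (f x) (just false)

    -- Inputs outside the domain must not contribute generators: orthogonality to the final states
    -- with value true is known only for inputs with value false.
    span = L.spanProjector n 1 definite φ (filter isFalse? (bitVectors n))
    open L.SpanProjector n 1 span
    open L.Complement n 1 isProjector

    P : Bool → Operator {n} {1}
    P false = operator
    P true  = complement

    P-projector : ∀ b → L.IsProjector n 1 (P b)
    P-projector false = isProjector
    P-projector true  = complement-isProjector

    A : OneQueryAlgorithm n
    A = record
      { m           = 1
      ; ψ₀          = ψ₀
      ; U₀          = 𝟙
      ; U₁          = 𝟙
      ; P           = P
      ; normalised  = ψ₀-normalised
      ; U₀-unitary  = 𝟙-unitary
      ; U₁-unitary  = 𝟙-unitary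
      ; measurement = record
        { selfAdjoint = λ b → L.IsProjector.selfAdjoint (P-projector b)
        ; idempotent  = λ b → L.IsProjector.idempotent (P-projector b)
        ; orthogonal  = λ
          { false false b≢c → contradiction ≡.refl b≢c
          ; false true  _   → ⊡-complement
          ; true  false _   → complement-⊡
          ; true  true  b≢c → contradiction ≡.refl b≢c
          }
        ; complete    = complement-complete
        }
      }

    -- A final state with value false is a generator of the span and hence fixed. One with value
    -- true is orthogonal to all generators, so the span projector kills it and the complement fixes
    -- it.
    accepts : ∀ x b → f x ≡ just b → L._≈ₛ_ n 1 (P b · φ x) (φ x)
    accepts x false fx≡0 = fixes (∈-filter⁺ isFalse? (∈-bitVectors x) fx≡0)
    accepts y true  fy≡1 b = begin
      (complement · φ y) b                ≈⟨ complement-· (φ y) b ⟩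
      φ y b ℂᵣ.- (operator · φ y) b       ≈⟨ ℂᵣ.+-congˡ {φ y b} (ℂᵣ.-‿cong (kills {φ y} ⊥φy b)) ⟩
      φ y b ℂᵣ.- ℂᵣ.0#                    ≈⟨ ℂS.solve 1 (λ z → z ℂS.:- ℂS.:0 ℂS.:= z) ℂᵣ.refl (φ y b) ⟩
      φ y b                               ∎
      where
      open ℂR
      ⊥φy : ∀ {x} → x ∈ filter isFalse? (bitVectors n) → L.⟨_∣_⟩ n 1 (φ x) (φ y) ℂᵣ.≈ ℂᵣ.0#
      ⊥φy {x} x∈ = φ⊥ x y (proj₂ (∈-filter⁻ isFalse? {xs = bitVectors n} x∈)) fy≡1

    exact : ComputesExactly A f
    exact x b fx≡b = ℝᵣ.trans (∥∥²-cong (accepts x b fx≡b)) (φ-normalised x)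

theorem1 : (ℝ : CompleteOrderedField) →
    let open CompleteOrderedField ℝ
        open Quantum ℝ
    in
    ∀ (n : ℕ) (f : PartialBooleanFunction n) → NonConstant f →
    OneQueryComputable f ⇔
    (∃ λ (β : Vector Carrier (suc n)) →
      (∀ (i : Fin (suc n)) → 0# ≤ β i) × sum β ≈ 1# ×
      (∀ (x y : Vec Bool n) → f x ≡ just false → f y ≡ just true →
        β zero + sum (λ (i : Fin n) → β (suc i) * sign (lookup x i xor lookup y i)) ≈ 0#))
theorem1 ℝ n f _ = mk⇔ (computable⇒separating f) (separating⇒computable f)
  where open QueryStates ℝ
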